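{- Let $p\in\sum\mathbb C\langle\underline z\rangle_d^2$ and let $\varepsilon>0$. Then the $\varepsilon$-ball $\{q\in\mathbb C\langle\underline z\rangle\mid\Vert p-q\Vert_2\leqslant\varepsilon\}$ around $p$ with respect to $\Vert\cdot\Vert_2$ contains a sum of at most $$\frac{\left(\sum_{\vert\nu\vert=d}p_{\nu^*\nu}\right)^2}{\varepsilon^2}$$ many Hermitian squares $w^*w$ of elements $w\in\mathbb C\langle\underline z\rangle_d$.
   Context: $\mathbb C\langle\underline z\rangle$ is the free $*$-algebra of non-commutative polynomials over $\mathbb C$ in the Hermitian variables $z_1,\ldots,z_n$: the involution is the conjugate-linear anti-automorphism with $z_i^*=z_i$, i.e. it reverses words and conjugates coefficients. $\mathbb C\langle\underline z\rangle_d$ is the subspace of homogeneous polynomials of degree $d$, with basis the words of length $d$. $\sum\mathbb C\langle\underline z\rangle_d^2$ is the set of all finite sums $\sum_k w_k^*w_k$ with $w_k\in\mathbb C\langle\underline z\rangle_d$; the empty sum (zero squares) equals $0$. For $p=\sum_\omega p_\omega\omega$, where $\omega$ ranges over words and $p_\omega\in\mathbb C$, the coefficient $2$-norm is $\Vert p\Vert_2=\left(\sum_\omega\vert p_\omega\vert^2\right)^{1/2}$. The sum $\sum_{\vert\nu\vert=d}p_{\nu^*\nu}$ runs over all words $\nu$ of length $d$ in $z_1,\ldots,z_n$, and $p_{\nu^*\nu}$ is the coefficient in $p$ of the word $\nu^*\nu$ (the reversal of $\nu$ followed by $\nu$). -}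

module Defs where

open import Algebra.Bundles using (CommutativeRing)
open import Algebra.Definitions using (Invertible)
open import Data.Fin.Base using (Fin)
open import Data.List.Base using (List; []; _∷_; _++_; map; foldr; concatMap; cartesianProductWith; allFin; upTo; length; reverse)
open import Data.List.Properties using (length-reverse)
open import Data.List.Relation.Unary.All as All using (All; []; _∷_)
open import Data.List.Relation.Unary.All.Properties using (map⁺)
open import Data.Nat.Base as ℕ using (ℕ; _⊔_)
import Data.Nat.Properties as ℕₚ
open import Data.Product.Base using (Σ-syntax; ∃-syntax; _×_; _,_; proj₁; proj₂; map₁)
open import Data.Sum.Base using (_⊎_; inj₁; inj₂)
import Data.Vec.Functional as Vector
open import Function.Base using (_∘_)
open import Level using (0ℓ)
open import Relation.Binary.Core using (Rel)
open import Relation.Binary.Structures using (IsDecTotalOrder)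
import Relation.Binary.Construct.NonStrictToStrict as ToStrict
open import Relation.Binary.PropositionalEquality.Core as ≡ using (_≡_; _≢_)
open import Relation.Nullary.Decidable.Core using (yes; no)
open import Relation.Nullary.Negation.Core using (¬_; contradiction)
open import Relation.Unary using (Pred)

module _ {A : Set} (_≤_ : Rel A 0ℓ) where

  IsUpperBound : Pred A 0ℓ → A → Set
  IsUpperBound S b = ∀ x → S x → x ≤ b

  IsLeastUpperBound : Pred A 0ℓ → A → Set
  IsLeastUpperBound S s = IsUpperBound S s × (∀ b → IsUpperBound S b → s ≤ b)

-- The classical axioms characterising ℝ up to unique isomorphism. The order
-- is decidable, so this is the classical rather than a constructive continuum.
-- A predicate in `complete` need not respect _≈_: its closure under _≈_ has
-- the same upper bounds.
record CompleteOrderedField : Set₁ where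
  field
    commutativeRing : CommutativeRing 0ℓ 0ℓ

  open CommutativeRing commutativeRing public

  infix 4 _≤_ _<_

  field
    _≤_             : Rel Carrier 0ℓ
    isDecTotalOrder : IsDecTotalOrder _≈_ _≤_
    0≉1             : ¬ 0# ≈ 1#
    invertible      : ∀ x → ¬ x ≈ 0# → Invertible _≈_ 1# _*_ x
    +-monoʳ-≤       : ∀ z {x y} → x ≤ y → z + x ≤ z + y
    *-nonneg        : ∀ {x y} → 0# ≤ x → 0# ≤ y → 0# ≤ x * y
    complete        : (S : Pred Carrier 0ℓ) → (∃[ x ] S x) → (∃[ b ] IsUpperBound _≤_ S b) →
                      ∃[ s ] IsLeastUpperBound _≤_ S s

  open IsDecTotalOrder isDecTotalOrder public
    using (_≟_; _≤?_; total; antisym; ≤-respˡ-≈; ≤-respʳ-≈)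
    renaming (refl to ≤-refl; reflexive to ≤-reflexive; trans to ≤-trans)

  _<_ : Rel Carrier 0ℓ
  _<_ = ToStrict._<_ _≈_ _≤_

module SquareRoot (R : CompleteOrderedField) where

  open CompleteOrderedField R
  open import Algebra.Properties.Ring ring using (-‿distribˡ-*; -‿distribʳ-*; -‿involutive)
  open import Algebra.Solver.Ring.NaturalCoefficients.Default commutativeSemiring
    using (solve; _:=_; _:+_; _:*_; con)
  open import Relation.Binary.Reasoning.Setoid setoid

  x+y-x≈y : ∀ x y → x + (y - x) ≈ y
  x+y-x≈y x y = begin
    x + (y - x)    ≈⟨ +-congˡ (+-comm y (- x)) ⟩
    x + (- x + y)  ≈⟨ +-assoc x (- x) y ⟨
    (x - x) + y    ≈⟨ +-congʳ (-‿inverseʳ x) ⟩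
    0# + y         ≈⟨ +-identityˡ y ⟩
    y              ∎

  x≤y⇒0≤y-x : ∀ {x y} → x ≤ y → 0# ≤ y - x
  x≤y⇒0≤y-x {x} {y} x≤y =
    ≤-respˡ-≈ (-‿inverseˡ x) (≤-respʳ-≈ (+-comm (- x) y) (+-monoʳ-≤ (- x) x≤y))

  x≤x+y : ∀ x {y} → 0# ≤ y → x ≤ x + y
  x≤x+y x 0≤y = ≤-respˡ-≈ (+-identityʳ x) (+-monoʳ-≤ x 0≤y)

  +-nonneg : ∀ {x y} → 0# ≤ x → 0# ≤ y → 0# ≤ x + y
  +-nonneg {x} 0≤x 0≤y = ≤-trans 0≤x (x≤x+y x 0≤y)

  x+y≤x⇒y≤0 : ∀ {x y} → x + y ≤ x → y ≤ 0#
  x+y≤x⇒y≤0 {x} {y} h = ≤-respˡ-≈ eq (≤-respʳ-≈ (-‿inverseˡ x) (+-monoʳ-≤ (- x) h))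
    where
    eq : - x + (x + y) ≈ y
    eq = begin
      - x + (x + y)  ≈⟨ +-assoc (- x) x y ⟨
      (- x + x) + y  ≈⟨ +-congʳ (-‿inverseˡ x) ⟩
      0# + y         ≈⟨ +-identityˡ y ⟩
      y              ∎

  neg-nonneg : ∀ {x} → x ≤ 0# → 0# ≤ - x
  neg-nonneg {x} x≤0 = ≤-respʳ-≈ (+-identityˡ (- x)) (x≤y⇒0≤y-x x≤0)

  square-nonneg : ∀ x → 0# ≤ x * x
  square-nonneg x with total 0# x
  ... | inj₁ 0≤x = *-nonneg 0≤x 0≤x
  ... | inj₂ x≤0 = ≤-respʳ-≈ eq (*-nonneg (neg-nonneg x≤0) (neg-nonneg x≤0))
    where
    eq : - x * - x ≈ x * x
    eq = begin
      - x * - x      ≈⟨ -‿distribˡ-* x (- x) ⟨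
      - (x * - x)    ≈⟨ -‿cong (-‿distribʳ-* x x) ⟨
      - (- (x * x))  ≈⟨ -‿involutive (x * x) ⟩
      x * x          ∎

  0≤1 : 0# ≤ 1#
  0≤1 = ≤-respʳ-≈ (*-identityˡ 1#) (square-nonneg 1#)

  *-cancel-0 : ∀ {x y} → ¬ y ≈ 0# → x * y ≈ 0# → x ≈ 0#
  *-cancel-0 {x} {y} y≉0 xy≈0 with invertible y y≉0
  ... | y⁻¹ , _ , yy⁻¹≈1 = begin
    x              ≈⟨ *-identityʳ x ⟨
    x * 1#         ≈⟨ *-congˡ yy⁻¹≈1 ⟨
    x * (y * y⁻¹)  ≈⟨ *-assoc x y y⁻¹ ⟨
    x * y * y⁻¹    ≈⟨ *-congʳ xy≈0 ⟩
    0# * y⁻¹       ≈⟨ zeroˡ y⁻¹ ⟩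
    0#             ∎

  square≉0 : ∀ {x} → ¬ x ≈ 0# → ¬ x * x ≈ 0#
  square≉0 x≉0 xx≈0 = x≉0 (*-cancel-0 x≉0 xx≈0)

  square≤0⇒≈0 : ∀ {x} → x * x ≤ 0# → x ≈ 0#
  square≤0⇒≈0 {x} xx≤0 with x ≟ 0#
  ... | yes x≈0 = x≈0
  ... | no  x≉0 = contradiction (antisym xx≤0 (square-nonneg x)) (square≉0 x≉0)

  square-cancel-≤ : ∀ {x y} → 0# ≤ y → x * x ≤ y * y → x ≤ y
  square-cancel-≤ {x} {y} 0≤y xx≤yy with total x y
  ... | inj₁ x≤y = x≤y
  ... | inj₂ y≤x = ≤-reflexive (begin
    x            ≈⟨ x+y-x≈y y x ⟨
    y + (x - y)  ≈⟨ +-congˡ (square≤0⇒≈0 ee≤0) ⟩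
    y + 0#       ≈⟨ +-identityʳ y ⟩
    y            ∎)
    where
    e = x - y
    0≤e = x≤y⇒0≤y-x y≤x
    expand : x * x ≈ y * y + (e * e + (y * e + y * e))
    expand = begin
      x * x                                ≈⟨ *-cong (x+y-x≈y y x) (x+y-x≈y y x) ⟨
      (y + e) * (y + e)                    ≈⟨ solve 2 (λ y e → (y :+ e) :* (y :+ e) :=
                                                y :* y :+ (e :* e :+ (y :* e :+ y :* e))) refl y e ⟩
      y * y + (e * e + (y * e + y * e))    ∎
    ee≤0 : e * e ≤ 0#
    ee≤0 = ≤-trans (x≤x+y (e * e) (+-nonneg (*-nonneg 0≤y 0≤e) (*-nonneg 0≤y 0≤e)))
             (x+y≤x⇒y≤0 (≤-respˡ-≈ expand xx≤yy))

  inverse-nonneg : ∀ {x y} → 0# ≤ x → x * y ≈ 1# → 0# ≤ y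
  inverse-nonneg {x} {y} 0≤x xy≈1 with total 0# y
  ... | inj₁ 0≤y = 0≤y
  ... | inj₂ y≤0 = contradiction (antisym 0≤1 1≤0) 0≉1
    where
    0≤-1 : 0# ≤ - 1#
    0≤-1 = ≤-respʳ-≈ (trans (sym (-‿distribʳ-* x y)) (-‿cong xy≈1)) (*-nonneg 0≤x (neg-nonneg y≤0))
    1≤0 : 1# ≤ 0#
    1≤0 = ≤-respʳ-≈ (-‿inverseʳ 1#) (x≤x+y 1# 0≤-1)

  SquareBelow : Carrier → Pred Carrier 0ℓ
  SquareBelow x y = y * y ≤ x

  -- The auxiliary point y = (as + x)/(s + a) with a = 1 + x satisfies
  -- y² - x = (a² - x)(s² - x)/(s + a)² and y - s = (x - s²)/(s + a).
  module _ {x s : Carrier} (0≤x : 0# ≤ x) (lub : IsLeastUpperBound _≤_ (SquareBelow x) s) where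

    private
      a = 1# + x
      t = s + a
      0≤s : 0# ≤ s
      0≤s = proj₁ lub 0# (≤-respˡ-≈ (sym (zeroˡ 0#)) 0≤x)
      1≤t : 1# ≤ t
      1≤t = ≤-respʳ-≈ (solve 2 (λ x s → con 1 :+ (x :+ s) := s :+ (con 1 :+ x)) refl x s)
              (x≤x+y 1# (+-nonneg 0≤x 0≤s))
      t≉0 : ¬ t ≈ 0#
      t≉0 t≈0 = 0≉1 (antisym 0≤1 (≤-respʳ-≈ t≈0 1≤t))
      r = proj₁ (invertible t t≉0)
      tr≈1 : t * r ≈ 1#
      tr≈1 = proj₂ (proj₂ (invertible t t≉0))
      0≤r : 0# ≤ r
      0≤r = inverse-nonneg (≤-trans 0≤1 1≤t) tr≈1
      y = (a * s + x) * r
      p = 1# + (x + x * x)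
      0≤p : 0# ≤ p
      0≤p = +-nonneg 0≤1 (+-nonneg 0≤x (square-nonneg x))

      ·tr : ∀ u → u * (t * r) ≈ u
      ·tr u = trans (*-congˡ tr≈1) (*-identityʳ u)

      finish : ∀ {q} → 0# ≤ q → q * r ≤ 0# → q ≈ 0#
      finish {q} 0≤q qr≤0 = begin
        q            ≈⟨ ·tr q ⟨
        q * (t * r)  ≈⟨ solve 3 (λ q t r → q :* (t :* r) := q :* r :* t) refl q t r ⟩
        q * r * t    ≈⟨ *-congʳ (antisym qr≤0 (*-nonneg 0≤q 0≤r)) ⟩
        0# * t       ≈⟨ zeroˡ t ⟩
        0#           ∎

      r²-nonneg : ∀ {q} → 0# ≤ q → 0# ≤ p * q * (r * r)
      r²-nonneg 0≤q = *-nonneg (*-nonneg 0≤p 0≤q) (square-nonneg r)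

    excess≈0 : ∀ q → 0# ≤ q → s * s ≈ x + q → q ≈ 0#
    excess≈0 q 0≤q ss≈x+q = finish 0≤q (x+y≤x⇒y≤0 (≤-respˡ-≈ s≈y+qr s≤y))
      where
      s≈y+qr : s ≈ y + q * r
      s≈y+qr = begin
        s                        ≈⟨ ·tr s ⟨
        s * (t * r)              ≈⟨ solve 3 (λ s a r → s :* ((s :+ a) :* r) := (a :* s :+ s :* s) :* r) refl s a r ⟩
        (a * s + s * s) * r      ≈⟨ *-congʳ (+-congˡ ss≈x+q) ⟩
        (a * s + (x + q)) * r    ≈⟨ solve 4 (λ u x q r → (u :+ (x :+ q)) :* r := (u :+ x) :* r :+ q :* r) refl (a * s) x q r ⟩
        y + q * r                ∎
      num : (a * s + x) * (a * s + x) ≈ x * (t * t) + p * q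
      num = begin
        (a * s + x) * (a * s + x)
          ≈⟨ solve 3 (λ a s x → (a :* s :+ x) :* (a :* s :+ x) :=
               a :* a :* (s :* s) :+ ((a :* s :* x) :+ (a :* s :* x) :+ x :* x)) refl a s x ⟩
        a * a * (s * s) + ((a * s * x) + (a * s * x) + x * x)
          ≈⟨ +-congʳ (*-congˡ ss≈x+q) ⟩
        a * a * (x + q) + ((a * s * x) + (a * s * x) + x * x)
          ≈⟨ solve 3 (λ s x q → let a = con 1 :+ x in
               a :* a :* (x :+ q) :+ ((a :* s :* x) :+ (a :* s :* x) :+ x :* x) :=
               x :* (x :+ q) :+ (x :* (a :* s :+ a :* s :+ a :* a) :+ (con 1 :+ (x :+ x :* x)) :* q)) refl s x q ⟩
        x * (x + q) + (x * (a * s + a * s + a * a) + p * q)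
          ≈⟨ +-congʳ (*-congˡ ss≈x+q) ⟨
        x * (s * s) + (x * (a * s + a * s + a * a) + p * q)
          ≈⟨ solve 4 (λ a s x z → x :* (s :* s) :+ (x :* (a :* s :+ a :* s :+ a :* a) :+ z) :=
               x :* ((s :+ a) :* (s :+ a)) :+ z) refl a s x (p * q) ⟩
        x * (t * t) + p * q ∎
      yy : y * y ≈ x + p * q * (r * r)
      yy = begin
        y * y                                       ≈⟨ solve 2 (λ u r → u :* r :* (u :* r) := u :* u :* (r :* r)) refl (a * s + x) r ⟩
        (a * s + x) * (a * s + x) * (r * r)         ≈⟨ *-congʳ num ⟩
        (x * (t * t) + p * q) * (r * r)             ≈⟨ solve 4 (λ x t z r → (x :* (t :* t) :+ z) :* (r :* r) := x :* (t :* r) :* (t :* r) :+ z :* (r :* r)) refl x t (p * q) r ⟩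
        x * (t * r) * (t * r) + p * q * (r * r)     ≈⟨ +-congʳ (trans (·tr (x * (t * r))) (·tr x)) ⟩
        x + p * q * (r * r)                         ∎
      0≤y : 0# ≤ y
      0≤y = *-nonneg (+-nonneg (*-nonneg (+-nonneg 0≤1 0≤x) 0≤s) 0≤x) 0≤r
      s≤y : s ≤ y
      s≤y = proj₂ lub y λ z zz≤x → square-cancel-≤ 0≤y
              (≤-trans zz≤x (≤-respʳ-≈ (sym yy) (x≤x+y x (r²-nonneg 0≤q))))

    deficit≈0 : ∀ q → 0# ≤ q → x ≡ s * s + q → q ≈ 0#
    deficit≈0 q 0≤q ≡.refl = finish 0≤q (x+y≤x⇒y≤0 (≤-respˡ-≈ y≈s+qr y≤s))
      where
      y≈s+qr : y ≈ s + q * r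
      y≈s+qr = begin
        (a * s + (s * s + q)) * r  ≈⟨ solve 4 (λ a s q r → (a :* s :+ (s :* s :+ q)) :* r := s :* ((s :+ a) :* r) :+ q :* r) refl a s q r ⟩
        s * (t * r) + q * r        ≈⟨ +-congʳ (·tr s) ⟩
        s + q * r                  ∎
      yy : y * y + p * q * (r * r) ≈ x
      yy = begin
        y * y + p * q * (r * r)
          ≈⟨ solve 3 (λ s q r → let x = s :* s :+ q
                                    a = con 1 :+ x
                                    t = s :+ a
                                    u = (a :* s :+ x) :* r in
               u :* u :+ (con 1 :+ (x :+ x :* x)) :* q :* (r :* r) := x :* (t :* r) :* (t :* r)) refl s q r ⟩
        x * (t * r) * (t * r)  ≈⟨ trans (·tr (x * (t * r))) (·tr x) ⟩
        x                      ∎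
      y≤s : y ≤ s
      y≤s = proj₁ lub y (≤-respʳ-≈ yy (x≤x+y (y * y) (r²-nonneg 0≤q)))

  lub⇒root : ∀ {x s} → 0# ≤ x → IsLeastUpperBound _≤_ (SquareBelow x) s → s * s ≈ x
  lub⇒root {x} {s} 0≤x lub with total (s * s) x
  ... | inj₂ x≤ss = begin
    s * s            ≈⟨ x+y-x≈y x (s * s) ⟨
    x + (s * s - x)  ≈⟨ +-congˡ (excess≈0 {x} {s} 0≤x lub (s * s - x) (x≤y⇒0≤y-x x≤ss) (sym (x+y-x≈y x (s * s)))) ⟩
    x + 0#           ≈⟨ +-identityʳ x ⟩
    x                ∎
  ... | inj₁ ss≤x = begin
    s * s       ≈⟨ +-identityʳ (s * s) ⟨
    s * s + 0#  ≈⟨ +-congˡ q≈0 ⟨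
    s * s + q   ≈⟨ x′≈x ⟩
    x           ∎
    where
    q x′ : Carrier
    q  = x - s * s
    x′ = s * s + q
    x′≈x : x′ ≈ x
    x′≈x = x+y-x≈y (s * s) x
    lub′ : IsLeastUpperBound _≤_ (SquareBelow x′) s
    lub′ = (λ y yy≤x′ → proj₁ lub y (≤-respʳ-≈ x′≈x yy≤x′))
         , (λ b ub → proj₂ lub b λ y yy≤x → ub y (≤-respʳ-≈ (sym x′≈x) yy≤x))
    q≈0 : q ≈ 0#
    q≈0 = deficit≈0 {x′} {s} (≤-respʳ-≈ (sym x′≈x) 0≤x) lub′ q (x≤y⇒0≤y-x ss≤x) ≡.refl

  sqrt-exists : ∀ x → 0# ≤ x → ∃[ s ] 0# ≤ s × s * s ≈ x
  sqrt-exists x 0≤x = s , proj₁ lub 0# zero∈ , lub⇒root 0≤x lub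
    where
    bounded : IsUpperBound _≤_ (SquareBelow x) (1# + x)
    bounded y yy≤x = square-cancel-≤ (+-nonneg 0≤1 0≤x) (≤-trans yy≤x
      (≤-respʳ-≈ (solve 1 (λ x → x :+ (con 1 :+ (x :+ x :* x)) := (con 1 :+ x) :* (con 1 :+ x)) refl x)
        (x≤x+y x (+-nonneg 0≤1 (+-nonneg 0≤x (square-nonneg x))))))
    zero∈ : SquareBelow x 0#
    zero∈ = ≤-respˡ-≈ (sym (zeroˡ 0#)) 0≤x
    sup = complete (SquareBelow x) (0# , zero∈) (1# + x , bounded)
    s   = proj₁ sup
    lub = proj₂ sup

  √ : ∀ x → 0# ≤ x → Carrier
  √ x 0≤x = proj₁ (sqrt-exists x 0≤x)

Word : ℕ → Set
Word n = List (Fin n)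

words : ∀ n → ℕ → List (Word n)
words n ℕ.zero    = [] ∷ []
words n (ℕ.suc d) = cartesianProductWith _∷_ (allFin n) (words n d)

words≤ : ∀ n → ℕ → List (Word n)
words≤ n d = concatMap (words n) (upTo (ℕ.suc d))

-- All pairs (u , v) with u ++ v ≡ ω.
factorisations : ∀ {n} → Word n → List (Word n × Word n)
factorisations []      = ([] , []) ∷ []
factorisations (i ∷ ω) = ([] , i ∷ ω) ∷ map (map₁ (i ∷_)) (factorisations ω)

factorisations-length : ∀ {n} (ω : Word n) →
  All (λ uv → length (proj₁ uv) ℕ.+ length (proj₂ uv) ≡ length ω) (factorisations ω)
factorisations-length []      = ≡.refl ∷ []
factorisations-length (i ∷ ω) = ≡.refl ∷ map⁺ (All.map (≡.cong ℕ.suc) (factorisations-length ω))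

module FreeStarAlgebra (R : CompleteOrderedField) where

  open CompleteOrderedField R public
    using (_≈_; _≤_; _<_; _+_; _*_; -_; _-_; 0#; 1#)
    renaming (Carrier to ℝ)
  private module R = CompleteOrderedField R
  open SquareRoot R using (√; +-nonneg; square-nonneg; square≉0)
  open import Algebra.Properties.Semiring.Mult R.semiring using () renaming (_×_ to _·_)
  open import Algebra.Properties.Ring R.ring using (-0#≈0#)

  fromℕ : ℕ → ℝ
  fromℕ m = m · 1#

  ∑ℝ : ∀ {A : Set} → List A → (A → ℝ) → ℝ
  ∑ℝ xs f = foldr (λ x s → f x + s) 0# xs

  ∑ℝ-nonneg : ∀ {A : Set} (xs : List A) {f : A → ℝ} → (∀ x → 0# ≤ f x) → 0# ≤ ∑ℝ xs f
  ∑ℝ-nonneg []       0≤f = R.≤-refl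
  ∑ℝ-nonneg (x ∷ xs) 0≤f = +-nonneg (0≤f x) (∑ℝ-nonneg xs 0≤f)

  infix  4 _≈ᶜ_ _≤ᶜ_
  infixl 6 _+ᶜ_
  infixl 7 _*ᶜ_

  record ℂ : Set where
    constructor _+i_
    field
      re im : ℝ

  open ℂ public

  _≈ᶜ_ : ℂ → ℂ → Set
  a ≈ᶜ b = re a ≈ re b × im a ≈ im b

  -- a ≤ᶜ b means that b - a is real and nonnegative.
  _≤ᶜ_ : ℂ → ℂ → Set
  a ≤ᶜ b = re a ≤ re b × im a ≈ im b

  ofℝ : ℝ → ℂ
  ofℝ x = x +i 0#

  0ᶜ : ℂ
  0ᶜ = ofℝ 0#

  _+ᶜ_ _*ᶜ_ : ℂ → ℂ → ℂ
  a +ᶜ b = (re a + re b) +i (im a + im b)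
  a *ᶜ b = (re a * re b - im a * im b) +i (re a * im b + im a * re b)

  -ᶜ_ conj : ℂ → ℂ
  -ᶜ a   = (- re a) +i (- im a)
  conj a = re a +i (- im a)

  ∣_∣² : ℂ → ℝ
  ∣ a ∣² = re a * re a + im a * im a

  ∣∣²-nonneg : ∀ a → 0# ≤ ∣ a ∣²
  ∣∣²-nonneg a = +-nonneg (square-nonneg (re a)) (square-nonneg (im a))

  divide : ℂ → (x : ℝ) → ¬ x ≈ 0# → ℂ
  divide a x x≉0 = a *ᶜ ofℝ (proj₁ (R.invertible x x≉0))

  ∑ᶜ : ∀ {A : Set} → List A → (A → ℂ) → ℂ
  ∑ᶜ xs f = foldr (λ x s → f x +ᶜ s) 0ᶜ xs

  +ᶜ-0 : ∀ {a b} → a ≈ᶜ 0ᶜ → b ≈ᶜ 0ᶜ → a +ᶜ b ≈ᶜ 0ᶜ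
  +ᶜ-0 (a≈0 , a′≈0) (b≈0 , b′≈0) =
    R.trans (R.+-cong a≈0 b≈0) (R.+-identityˡ 0#) , R.trans (R.+-cong a′≈0 b′≈0) (R.+-identityˡ 0#)

  neg-0 : ∀ {x} → x ≈ 0# → - x ≈ 0#
  neg-0 x≈0 = R.trans (R.-‿cong x≈0) -0#≈0#

  *-0ˡ : ∀ {x} y → x ≈ 0# → x * y ≈ 0#
  *-0ˡ y x≈0 = R.trans (R.*-congʳ x≈0) (R.zeroˡ y)

  *-0ʳ : ∀ x {y} → y ≈ 0# → x * y ≈ 0#
  *-0ʳ x y≈0 = R.trans (R.*-congˡ y≈0) (R.zeroʳ x)

  +-0 : ∀ {x y} → x ≈ 0# → y ≈ 0# → x + y ≈ 0#
  +-0 x≈0 y≈0 = R.trans (R.+-cong x≈0 y≈0) (R.+-identityˡ 0#)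

  *ᶜ-0ˡ : ∀ {a} b → a ≈ᶜ 0ᶜ → a *ᶜ b ≈ᶜ 0ᶜ
  *ᶜ-0ˡ b (re≈0 , im≈0) =
    +-0 (*-0ˡ (re b) re≈0) (neg-0 (*-0ˡ (im b) im≈0)) , +-0 (*-0ˡ (im b) re≈0) (*-0ˡ (re b) im≈0)

  *ᶜ-0ʳ : ∀ a {b} → b ≈ᶜ 0ᶜ → a *ᶜ b ≈ᶜ 0ᶜ
  *ᶜ-0ʳ a (re≈0 , im≈0) =
    +-0 (*-0ʳ (re a) re≈0) (neg-0 (*-0ʳ (im a) im≈0)) , +-0 (*-0ʳ (re a) im≈0) (*-0ʳ (im a) re≈0)

  ∑ᶜ-0 : ∀ {A : Set} {xs : List A} {f : A → ℂ} → All (λ x → f x ≈ᶜ 0ᶜ) xs → ∑ᶜ xs f ≈ᶜ 0ᶜ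
  ∑ᶜ-0 []       = R.refl , R.refl
  ∑ᶜ-0 (h ∷ hs) = +ᶜ-0 h (∑ᶜ-0 hs)

  -- A finitely supported family of coefficients. As there are finitely many
  -- words of each length, finite support amounts to a bound on the degree;
  -- the bound carried along need not be sharp.
  record ℂ⟨z⟩ (n : ℕ) : Set where
    field
      coeff    : Word n → ℂ
      degree≤  : ℕ
      vanishes : ∀ ω → degree≤ ℕ.< length ω → coeff ω ≈ᶜ 0ᶜ

  open ℂ⟨z⟩ public

  infix  4 _≈ᴾ_
  infixl 6 _+ᴾ_ _-ᴾ_
  infixl 7 _*ᴾ_
  infix  9 _⋆

  _≈ᴾ_ : ∀ {n} → ℂ⟨z⟩ n → ℂ⟨z⟩ n → Set
  p ≈ᴾ q = ∀ ω → coeff p ω ≈ᶜ coeff q ω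

  0ᴾ : ∀ {n} → ℂ⟨z⟩ n
  0ᴾ = record { coeff = λ _ → 0ᶜ ; degree≤ = 0 ; vanishes = λ _ _ → R.refl , R.refl }

  _+ᴾ_ : ∀ {n} → ℂ⟨z⟩ n → ℂ⟨z⟩ n → ℂ⟨z⟩ n
  p +ᴾ q = record
    { coeff    = λ ω → coeff p ω +ᶜ coeff q ω
    ; degree≤  = degree≤ p ⊔ degree≤ q
    ; vanishes = λ ω h → +ᶜ-0
        (vanishes p ω (ℕₚ.≤-<-trans (ℕₚ.m≤m⊔n (degree≤ p) (degree≤ q)) h))
        (vanishes q ω (ℕₚ.≤-<-trans (ℕₚ.m≤n⊔m (degree≤ p) (degree≤ q)) h))
    }

  -ᴾ_ : ∀ {n} → ℂ⟨z⟩ n → ℂ⟨z⟩ n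
  -ᴾ p = record
    { coeff    = λ ω → -ᶜ coeff p ω
    ; degree≤  = degree≤ p
    ; vanishes = λ ω h → let re≈0 , im≈0 = vanishes p ω h in neg-0 re≈0 , neg-0 im≈0
    }

  _-ᴾ_ : ∀ {n} → ℂ⟨z⟩ n → ℂ⟨z⟩ n → ℂ⟨z⟩ n
  p -ᴾ q = p +ᴾ (-ᴾ q)

  _*ᴾ_ : ∀ {n} → ℂ⟨z⟩ n → ℂ⟨z⟩ n → ℂ⟨z⟩ n
  p *ᴾ q = record
    { coeff    = λ ω → ∑ᶜ (factorisations ω) term
    ; degree≤  = degree≤ p ℕ.+ degree≤ q
    ; vanishes = λ ω h → ∑ᶜ-0 (All.map (λ {uv} → term≈0 ω h uv) (factorisations-length ω))
    }
    where
    term : Word _ × Word _ → ℂ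
    term (u , v) = coeff p u *ᶜ coeff q v

    term≈0 : ∀ ω → degree≤ p ℕ.+ degree≤ q ℕ.< length ω → ∀ uv →
             length (proj₁ uv) ℕ.+ length (proj₂ uv) ≡ length ω → term uv ≈ᶜ 0ᶜ
    term≈0 ω h (u , v) eq with length u ℕₚ.≤? degree≤ p | length v ℕₚ.≤? degree≤ q
    ... | no  u≰ | _      = *ᶜ-0ˡ (coeff q v) (vanishes p u (ℕₚ.≰⇒> u≰))
    ... | yes _  | no  v≰ = *ᶜ-0ʳ (coeff p u) (vanishes q v (ℕₚ.≰⇒> v≰))
    ... | yes u≤ | yes v≤ =
      contradiction (≡.subst (ℕ._≤ _) eq (ℕₚ.+-mono-≤ u≤ v≤)) (ℕₚ.<⇒≱ h)

  _⋆ : ∀ {n} → ℂ⟨z⟩ n → ℂ⟨z⟩ n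
  p ⋆ = record
    { coeff    = λ ω → conj (coeff p (reverse ω))
    ; degree≤  = degree≤ p
    ; vanishes = λ ω h →
        let re≈0 , im≈0 = vanishes p (reverse ω) (≡.subst (degree≤ p ℕ.<_) (≡.sym (length-reverse ω)) h)
        in re≈0 , neg-0 im≈0
    }

  ∑ᴾ : ∀ {n m} → (Fin m → ℂ⟨z⟩ n) → ℂ⟨z⟩ n
  ∑ᴾ = Vector.foldr _+ᴾ_ 0ᴾ

  Homogeneous : ∀ {n} → ℕ → ℂ⟨z⟩ n → Set
  Homogeneous d p = ∀ ω → length ω ≢ d → coeff p ω ≈ᶜ 0ᶜ

  -- p is a sum of m Hermitian squares of elements of ℂ⟨z⟩_d; squares of zero
  -- are allowed.
  IsSumOfSquares : ∀ {n} → ℕ → ℕ → ℂ⟨z⟩ n → Set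
  IsSumOfSquares {n} d m p =
    Σ[ w ∈ (Fin m → ℂ⟨z⟩ n) ] (∀ k → Homogeneous d (w k)) × p ≈ᴾ ∑ᴾ (λ k → w k ⋆ *ᴾ w k)

  ∑ℂ⟨z⟩² : ∀ {n} → ℕ → Pred (ℂ⟨z⟩ n) 0ℓ
  ∑ℂ⟨z⟩² d p = ∃[ m ] IsSumOfSquares d m p

  ∥_∥₂² : ∀ {n} → ℂ⟨z⟩ n → ℝ
  ∥_∥₂² {n} p = ∑ℝ (words≤ n (degree≤ p)) (λ ω → ∣ coeff p ω ∣²)

  ∥_∥₂ : ∀ {n} → ℂ⟨z⟩ n → ℝ
  ∥_∥₂ {n} p = √ ∥ p ∥₂² (∑ℝ-nonneg (words≤ n (degree≤ p)) (λ ω → ∣∣²-nonneg (coeff p ω)))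

  Ball : ∀ {n} → ℂ⟨z⟩ n → ℝ → Pred (ℂ⟨z⟩ n) 0ℓ
  Ball p ε q = ∥ p -ᴾ q ∥₂ ≤ ε

  palindromeSum : ∀ {n} → ℕ → ℂ⟨z⟩ n → ℂ
  palindromeSum {n} d p = ∑ᶜ (words n d) (λ ν → coeff p (reverse ν ++ ν))

  0<⇒square≉0 : ∀ {x} → 0# < x → ¬ x * x ≈ 0#
  0<⇒square≉0 (_ , 0≉x) = square≉0 (0≉x ∘ R.sym)

{-# OPTIONS --safe #-}
module Submission where

-- Write p = ∑ c z with z = v* v, ∥v∥ = 1, and weights c = ∥w∥² whose sum t is the
-- palindrome sum; then ∥z∥ ≤ 1. By derandomised sampling (the approximate
-- Carathéodory theorem) one picks z₁, z₂, … greedily so that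
-- ∥∑_{i ≤ m} (t zᵢ - p)∥² ≤ m (t² - ∥p∥²): for every partial sum the c-weighted
-- mean over the next choice satisfies the bound, hence so does some choice.
-- Take m = ⌊t²/ε²⌋ and q = (t/m) ∑ zᵢ. If ∥p∥ ≤ ε then q = 0 works; otherwise
-- t² - ∥p∥² ≤ (m + 1) ε² - ε² = m ε² and therefore ∥p - q∥ ≤ ε. When the given
-- number M of squares already satisfies M ε² ≤ t², q = p works too.

open import Defs
open import Data.Bool.Base using (Bool; true; false)
open import Data.Fin.Base as Fin using (Fin)
open import Data.List.Base using (List; []; _∷_; _++_; _∷ʳ_; map; concatMap; cartesianProductWith;
  cartesianProduct; allFin; tabulate; lookup; upTo; length; reverse)
open import Data.List.Membership.Propositional using (_∈_)
open import Data.List.Membership.Propositional.Properties using (∈-allFin; ∈-cartesianProductWith⁺)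
open import Data.List.Properties using (length-reverse; unfold-reverse; reverse-involutive; tabulate-lookup)
open import Data.List.Relation.Unary.All as All using (All; []; _∷_)
open import Data.List.Relation.Unary.Any using (here; there)
open import Data.List.Relation.Unary.AllPairs using ([]; _∷_)
open import Data.List.Relation.Unary.Unique.Propositional using (Unique)
open import Data.List.Relation.Unary.Unique.Propositional.Properties using (upTo⁺)
open import Data.Nat.Base as ℕ using (ℕ)
import Data.Nat.Properties as ℕₚ
open import Data.Product.Base using (Σ-syntax; ∃-syntax; _×_; _,_; proj₁; proj₂; map₁)
open import Data.Sum.Base using (inj₁; inj₂)
open import Function.Base using (_∘_; id)
open import Relation.Binary.PropositionalEquality.Core as ≡ using (_≡_; _≢_)
open import Relation.Nullary.Decidable.Core using (Dec; yes; no)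
open import Relation.Nullary.Negation.Core using (¬_; contradiction)

-- Inequalities in an ordered field.

module OrderedField (R : CompleteOrderedField) where

  open CompleteOrderedField R
  open SquareRoot R
  open import Algebra.Solver.Ring.NaturalCoefficients.Default commutativeSemiring
    using (solve; _:=_; _:+_; _:*_; con)

  +-mono-≤ : ∀ {w x y z} → w ≤ x → y ≤ z → w + y ≤ x + z
  +-mono-≤ {w} {x} {y} {z} w≤x y≤z = ≤-trans (+-monoʳ-≤ w y≤z)
    (≤-respˡ-≈ (+-comm z w) (≤-respʳ-≈ (+-comm z x) (+-monoʳ-≤ z w≤x)))

  +-cancelˡ-≤ : ∀ x {y z} → x + y ≤ x + z → y ≤ z
  +-cancelˡ-≤ x {y} {z} h = ≤-respˡ-≈ (cancel y) (≤-respʳ-≈ (cancel z) (+-monoʳ-≤ (- x) h))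
    where
    cancel : ∀ y → - x + (x + y) ≈ y
    cancel y = trans (sym (+-assoc (- x) x y)) (trans (+-congʳ (-‿inverseˡ x)) (+-identityˡ y))

  *-monoˡ-≤ : ∀ {x y z} → 0# ≤ x → y ≤ z → x * y ≤ x * z
  *-monoˡ-≤ {x} {y} {z} 0≤x y≤z = ≤-respʳ-≈ eq (x≤x+y (x * y) (*-nonneg 0≤x (x≤y⇒0≤y-x y≤z)))
    where
    eq : x * y + x * (z - y) ≈ x * z
    eq = trans (sym (distribˡ x y (z - y))) (*-congˡ (x+y-x≈y y z))

  *-cancelˡ-≤ : ∀ {x y z} → 0# ≤ x → ¬ x ≈ 0# → x * y ≤ x * z → y ≤ z
  *-cancelˡ-≤ {x} {y} {z} 0≤x x≉0 h with invertible x x≉0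
  ... | r , rx≈1 , xr≈1 =
    ≤-respˡ-≈ (cancel y) (≤-respʳ-≈ (cancel z) (*-monoˡ-≤ (inverse-nonneg 0≤x xr≈1) h))
    where
    cancel : ∀ y → r * (x * y) ≈ y
    cancel y = trans (sym (*-assoc r x y)) (trans (*-congʳ rx≈1) (*-identityˡ y))

  -- Negation preserves squares, phrased with `x + y ≈ 0#` because the semiring solver treats a
  -- negative as an atom. Adding a suitable multiple of `x + y` to each side makes the two squares
  -- agree.
  +≈0⇒squares≈ : ∀ {x y} → x + y ≈ 0# → x * x ≈ y * y
  +≈0⇒squares≈ {x} {y} x+y≈0 = begin
    x * x                ≈⟨ +-identityʳ _ ⟨
    x * x + 0#           ≈⟨ +-congˡ (trans (*-congˡ x+y≈0) (zeroʳ y)) ⟨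
    x * x + y * (x + y)  ≈⟨ solve 2 (λ x y → x :* x :+ y :* (x :+ y) := y :* y :+ x :* (x :+ y)) refl x y ⟩
    y * y + x * (x + y)  ≈⟨ +-congˡ (trans (*-congˡ x+y≈0) (zeroʳ x)) ⟩
    y * y + 0#           ≈⟨ +-identityʳ _ ⟩
    y * y                ∎
    where open import Relation.Binary.Reasoning.Setoid setoid

  ≰⇒≥ : ∀ {x y} → ¬ x ≤ y → y ≤ x
  ≰⇒≥ {x} {y} x≰y with total x y
  ... | inj₁ x≤y = contradiction x≤y x≰y
  ... | inj₂ y≤x = y≤x

  -- d + m e ≤ d + m P ≤ m T ≤ m (m + 1) e.
  rounding : ∀ {m D d P T e} → 0# ≤ m → ¬ m ≈ 0# → m * (m * D) ≈ d →
             d + m * P ≤ m * T → T ≤ (1# + m) * e → e ≤ P → D ≤ e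
  rounding {m} {D} {d} {P} {T} {e} 0≤m m≉0 mmD≈d d+mP≤mT T≤ e≤P =
    *-cancelˡ-≤ 0≤m m≉0 (*-cancelˡ-≤ 0≤m m≉0 (≤-respˡ-≈ (sym mmD≈d) (+-cancelˡ-≤ (m * e) bound)))
    where
    bound : m * e + d ≤ m * e + m * (m * e)
    bound = ≤-trans (≤-respʳ-≈ (+-comm (m * P) d) (+-mono-≤ (*-monoˡ-≤ 0≤m e≤P) ≤-refl))
      (≤-trans d+mP≤mT (≤-respʳ-≈
        (solve 2 (λ m e → m :* ((con 1 :+ m) :* e) := m :* e :+ m :* (m :* e)) refl m e)
        (*-monoˡ-≤ 0≤m T≤)))

-- Finite sums and averaging.

module Sums (R : CompleteOrderedField) where

  open CompleteOrderedField R
  open SquareRoot R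
  open OrderedField R
  open FreeStarAlgebra R using (∑ℝ; ∑ℝ-nonneg)
  open import Relation.Binary.Reasoning.Setoid setoid
  open import Algebra.Solver.Ring.NaturalCoefficients.Default commutativeSemiring
    using (solve; _:=_; _:+_)

  module _ {A : Set} where

    ∑-cong : ∀ (xs : List A) {f g : A → Carrier} → (∀ x → f x ≈ g x) → ∑ℝ xs f ≈ ∑ℝ xs g
    ∑-cong []       f≈g = refl
    ∑-cong (x ∷ xs) f≈g = +-cong (f≈g x) (∑-cong xs f≈g)

    ∑-zero : ∀ (xs : List A) {f : A → Carrier} → (∀ {x} → x ∈ xs → f x ≈ 0#) → ∑ℝ xs f ≈ 0#
    ∑-zero []       f≈0 = refl
    ∑-zero (x ∷ xs) f≈0 =
      trans (+-cong (f≈0 (here ≡.refl)) (∑-zero xs (f≈0 ∘ there))) (+-identityˡ 0#)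

    ∑-mono : ∀ (xs : List A) {f g : A → Carrier} → (∀ x → f x ≤ g x) → ∑ℝ xs f ≤ ∑ℝ xs g
    ∑-mono []       f≤g = ≤-refl
    ∑-mono (x ∷ xs) f≤g = +-mono-≤ (f≤g x) (∑-mono xs f≤g)

    ∑-distrib-+ : ∀ (xs : List A) (f g : A → Carrier) →
                  ∑ℝ xs (λ x → f x + g x) ≈ ∑ℝ xs f + ∑ℝ xs g
    ∑-distrib-+ []       f g = sym (+-identityˡ 0#)
    ∑-distrib-+ (x ∷ xs) f g = trans (+-congˡ (∑-distrib-+ xs f g))
      (solve 4 (λ a b c d → (a :+ b) :+ (c :+ d) := (a :+ c) :+ (b :+ d)) refl
        (f x) (g x) (∑ℝ xs f) (∑ℝ xs g))

    *-distribˡ-∑ : ∀ (xs : List A) a (f : A → Carrier) → ∑ℝ xs (λ x → a * f x) ≈ a * ∑ℝ xs f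
    *-distribˡ-∑ []       a f = sym (zeroʳ a)
    *-distribˡ-∑ (x ∷ xs) a f =
      trans (+-congˡ (*-distribˡ-∑ xs a f)) (sym (distribˡ a (f x) (∑ℝ xs f)))

    *-distribʳ-∑ : ∀ (xs : List A) a (f : A → Carrier) → ∑ℝ xs (λ x → f x * a) ≈ ∑ℝ xs f * a
    *-distribʳ-∑ xs a f =
      trans (∑-cong xs (λ x → *-comm (f x) a)) (trans (*-distribˡ-∑ xs a f) (*-comm a _))

    ∑-++ : ∀ (xs ys : List A) (f : A → Carrier) → ∑ℝ (xs ++ ys) f ≈ ∑ℝ xs f + ∑ℝ ys f
    ∑-++ []       ys f = sym (+-identityˡ _)
    ∑-++ (x ∷ xs) ys f = trans (+-congˡ (∑-++ xs ys f)) (sym (+-assoc _ _ _))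

    term≤∑ : ∀ {xs : List A} {f : A → Carrier} {x} → (∀ x → 0# ≤ f x) → x ∈ xs → f x ≤ ∑ℝ xs f
    term≤∑ {x ∷ xs} {f} 0≤f (here ≡.refl) = x≤x+y (f x) (∑ℝ-nonneg xs 0≤f)
    term≤∑ {x ∷ xs} {f} 0≤f (there y∈xs) =
      ≤-respˡ-≈ (+-identityˡ _) (+-mono-≤ (0≤f x) (term≤∑ 0≤f y∈xs))

  ∑-map : ∀ {A B : Set} (g : A → B) (xs : List A) (f : B → Carrier) → ∑ℝ (map g xs) f ≡ ∑ℝ xs (f ∘ g)
  ∑-map g []       f = ≡.refl
  ∑-map g (x ∷ xs) f = ≡.cong (f (g x) +_) (∑-map g xs f)

  ∑-swap : ∀ {A B : Set} (xs : List A) (ys : List B) (f : A → B → Carrier) →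
           ∑ℝ xs (λ x → ∑ℝ ys (f x)) ≈ ∑ℝ ys (λ y → ∑ℝ xs (λ x → f x y))
  ∑-swap []       ys f = sym (∑-zero ys (λ _ → refl))
  ∑-swap (x ∷ xs) ys f =
    trans (+-congˡ (∑-swap xs ys f)) (sym (∑-distrib-+ ys (f x) (λ y → ∑ℝ xs (λ x → f x y))))

  ∑-concatMap : ∀ {A B : Set} (g : A → List B) (xs : List A) (f : B → Carrier) →
                ∑ℝ (concatMap g xs) f ≈ ∑ℝ xs (λ x → ∑ℝ (g x) f)
  ∑-concatMap g []       f = refl
  ∑-concatMap g (x ∷ xs) f = trans (∑-++ (g x) (concatMap g xs) f) (+-congˡ (∑-concatMap g xs f))

  ∑-cartesianProductWith : ∀ {A B C : Set} (g : A → B → C) (xs : List A) (ys : List B) (f : C → Carrier) →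
    ∑ℝ (cartesianProductWith g xs ys) f ≈ ∑ℝ xs (λ x → ∑ℝ ys (λ y → f (g x y)))
  ∑-cartesianProductWith g []       ys f = refl
  ∑-cartesianProductWith g (x ∷ xs) ys f = trans (∑-++ (map (g x) ys) _ f)
    (+-cong (reflexive (∑-map (g x) ys f)) (∑-cartesianProductWith g xs ys f))

  -- At most one entry contributes, since `xs` has no repetitions. As `a` may be missing from `xs`,
  -- only an inequality holds, and the empty list needs `0# ≤ b`.
  ∑-single-≤ : ∀ {xs : List ℕ} {f : ℕ → Carrier} {b} a → Unique xs → 0# ≤ b →
               (∀ x → x ≢ a → f x ≈ 0#) → f a ≤ b → ∑ℝ xs f ≤ b
  ∑-single-≤ a [] 0≤b f≈0 fa≤b = 0≤b
  ∑-single-≤ {x ∷ xs} {f} a (x∉xs ∷ uniq) 0≤b f≈0 fa≤b with x ℕₚ.≟ a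
  ... | yes ≡.refl = ≤-respˡ-≈ (trans (sym (+-identityʳ (f x))) (+-congˡ (sym
          (∑-zero xs λ {y} y∈xs → f≈0 y (All.lookup x∉xs y∈xs ∘ ≡.sym))))) fa≤b
  ... | no  x≢a    = ≤-respˡ-≈ (trans (sym (+-identityˡ _)) (+-congʳ (sym (f≈0 x x≢a))))
          (∑-single-≤ a uniq 0≤b f≈0 fa≤b)

  -- The averaging principle: some value is at most the weighted mean. The recursion keeps the
  -- smaller of the head's value and the value chosen in the tail; multiplying by the total weight
  -- avoids a division.
  weighted-min : ∀ {K : Set} (c f : K → Carrier) → (∀ k → 0# ≤ c k) → K → ∀ ks →
                 ∃[ l ] ∑ℝ ks c * f l ≤ ∑ℝ ks (λ k → c k * f k)
  -- The empty list has total weight zero, so any index will do and the supplied one is the default.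
  weighted-min c f 0≤c k []       = k , ≤-reflexive (zeroˡ (f k))
  weighted-min c f 0≤c k₀ (k ∷ ks) with weighted-min c f 0≤c k₀ ks
  ... | l , h with total (f k) (f l)
  ...   | inj₁ fk≤fl = k , ≤-respˡ-≈ (sym (distribʳ (f k) (c k) (∑ℝ ks c)))
            (+-monoʳ-≤ _ (≤-trans (*-monoˡ-≤ (∑ℝ-nonneg ks 0≤c) fk≤fl) h))
  ...   | inj₂ fl≤fk = l , ≤-respˡ-≈ (sym (distribʳ (f l) (c k) (∑ℝ ks c)))
            (+-mono-≤ (*-monoˡ-≤ (0≤c k) fl≤fk) h)

-- The approximate Carathéodory theorem in real coordinates.

module ApproximateCarathéodory (R : CompleteOrderedField) {A : Set} (xs : List A) where

  open CompleteOrderedField R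
  open SquareRoot R
  open OrderedField R
  open Sums R
  open FreeStarAlgebra R using (∑ℝ; ∑ℝ-nonneg; fromℕ)
  open import Relation.Binary.Reasoning.Setoid setoid
  open import Algebra.Solver.Ring.NaturalCoefficients.Default commutativeSemiring
    using (solve; _:=_; _:+_; _:*_; con)

  N : (A → Carrier) → Carrier
  N f = ∑ℝ xs (λ a → f a * f a)

  N-nonneg : ∀ f → 0# ≤ N f
  N-nonneg f = ∑ℝ-nonneg xs (λ a → square-nonneg (f a))

  -- Here `h` is `m (g - f)`, so both sides are its squared norm. This turns a bound on an
  -- accumulated error into one on the error of an average.
  N-rescale : ∀ m (f g h : A → Carrier) → (∀ a → h a + m * f a ≈ m * g a) → m * (m * N (λ a → f a - g a)) ≈ N h
  N-rescale m f g h eq = begin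
    m * (m * N (λ a → f a - g a))                            ≈⟨ *-assoc m m _ ⟨
    m * m * N (λ a → f a - g a)                              ≈⟨ *-distribˡ-∑ xs (m * m) _ ⟨
    ∑ℝ xs (λ a → m * m * ((f a - g a) * (f a - g a)))        ≈⟨ ∑-cong xs (λ a → trans
        (solve 2 (λ m x → m :* m :* (x :* x) := m :* x :* (m :* x)) refl m (f a - g a))
        (+≈0⇒squares≈ (cancel a))) ⟩
    N h                                                      ∎
    where
    cancel : ∀ a → m * (f a - g a) + h a ≈ 0#
    cancel a = begin
      m * (f a - g a) + h a            ≈⟨ solve 4 (λ m f n h → m :* (f :+ n) :+ h := (h :+ m :* f) :+ m :* n) refl m (f a) (- g a) (h a) ⟩
      (h a + m * f a) + m * - g a      ≈⟨ +-congʳ (eq a) ⟩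
      m * g a + m * - g a              ≈⟨ distribˡ m (g a) (- g a) ⟨
      m * (g a + - g a)                ≈⟨ *-congˡ (-‿inverseʳ (g a)) ⟩
      m * 0#                           ≈⟨ zeroʳ m ⟩
      0#                               ∎

  module _ {K : Set} (ks : List K) (c : K → Carrier) (z : K → A → Carrier) (p : A → Carrier) (t : Carrier)
           (0≤c : ∀ k → 0# ≤ c k) (∑c≈t : ∑ℝ ks c ≈ t)
           (∑cz≈p : ∀ a → ∑ℝ ks (λ k → c k * z k a) ≈ p a)
           (Nz≤1 : ∀ k → N (z k) ≤ 1#) where

    -- For nonzero `t` and probabilities `c k / t`, the vector `t z k` is an unbiased estimate of
    -- `p`. This is the total error of the sample `l`, left undivided by its length so that a new
    -- choice just adds one term.
    deviation : List K → A → Carrier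
    deviation l a = ∑ℝ l (λ k → t * z k a + - p a)

    deviation-expand : ∀ l a → deviation l a + fromℕ (length l) * p a ≈ t * ∑ℝ l (λ k → z k a)
    deviation-expand []      a = trans (+-congˡ (zeroˡ (p a))) (trans (+-identityˡ 0#) (sym (zeroʳ t)))
    deviation-expand (k ∷ l) a = begin
      (t * z k a + - p a) + deviation l a + (1# + fromℕ (length l)) * p a
        ≈⟨ solve 5 (λ tz n s m p → (tz :+ n) :+ s :+ (con 1 :+ m) :* p := (tz :+ (p :+ n)) :+ (s :+ m :* p)) refl
             (t * z k a) (- p a) (deviation l a) (fromℕ (length l)) (p a) ⟩
      (t * z k a + (p a + - p a)) + (deviation l a + fromℕ (length l) * p a)
        ≈⟨ +-cong (trans (+-congˡ (-‿inverseʳ (p a))) (+-identityʳ _)) (deviation-expand l a) ⟩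
      t * z k a + t * ∑ℝ l (λ k → z k a)
        ≈⟨ distribˡ t _ _ ⟨
      t * ∑ℝ (k ∷ l) (λ k → z k a) ∎

    -- The c-weighted mean of t z - p vanishes, so the cross term with s drops out.
    -- The term - t p² stands on the left so that semiring identities suffice.
    pointwise : ∀ s a →
      ∑ℝ ks (λ k → c k * (((t * z k a + - p a) + s) * ((t * z k a + - p a) + s))) + t * (p a * p a)
        ≈ t * (s * s) + t * t * ∑ℝ ks (λ k → c k * (z k a * z k a))
    pointwise s a = begin
      ∑ℝ ks (λ k → c k * (((t * z k a + n) + s) * ((t * z k a + n) + s))) + t * (p a * p a)
        ≈⟨ +-congʳ (∑-cong ks (λ k →
             solve 5 (λ c t z n s → c :* (((t :* z :+ n) :+ s) :* ((t :* z :+ n) :+ s)) :=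
                 (n :+ s) :* (n :+ s) :* c :+
                 ((t :* (n :+ s) :+ t :* (n :+ s)) :* (c :* z) :+ t :* t :* (c :* (z :* z))))
               refl (c k) t (z k a) n s)) ⟩
      ∑ℝ ks (λ k → u * u * c k + ((t * u + t * u) * (c k * z k a) + t * t * (c k * (z k a * z k a)))) + t * (p a * p a)
        ≈⟨ +-congʳ (trans (∑-distrib-+ ks _ _)
             (+-cong (trans (*-distribˡ-∑ ks (u * u) c) (*-congˡ ∑c≈t))
               (trans (∑-distrib-+ ks _ _)
                 (+-cong (trans (*-distribˡ-∑ ks (t * u + t * u) _) (*-congˡ (∑cz≈p a)))
                   (*-distribˡ-∑ ks (t * t) _))))) ⟩
      u * u * t + ((t * u + t * u) * p a + t * t * v) + t * (p a * p a)
        ≈⟨ solve 5 (λ t n s p v → (n :+ s) :* (n :+ s) :* t :+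
               ((t :* (n :+ s) :+ t :* (n :+ s)) :* p :+ t :* t :* v) :+ t :* (p :* p)
               := t :* ((p :+ n :+ s) :* (p :+ n :+ s)) :+ t :* t :* v) refl t n s (p a) v ⟩
      t * ((p a + n + s) * (p a + n + s)) + t * t * v
        ≈⟨ +-congʳ (*-congˡ (*-cong p+n+s≈s p+n+s≈s)) ⟩
      t * (s * s) + t * t * v ∎
      where
      n = - p a
      u = n + s
      v = ∑ℝ ks (λ k → c k * (z k a * z k a))
      p+n+s≈s : p a + n + s ≈ s
      p+n+s≈s = trans (+-congʳ (-‿inverseʳ (p a))) (+-identityˡ s)

    -- Summing `pointwise` over the coordinates gives an exact identity; the only loss is in
    -- bounding the weighted sum of the `N (z k)` by the total weight `t`. Keeping `N p` on the left
    -- retains the variance gain that the final rounding consumes.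
    mean : ∀ l → ∑ℝ ks (λ k → c k * (N (deviation (k ∷ l)) + N p)) ≤ t * (N (deviation l) + t * t)
    mean l = ≤-respˡ-≈ (sym eq) (≤-respʳ-≈
        (solve 2 (λ t n → t :* n :+ t :* t :* t := t :* (n :+ t :* t)) refl t (N (deviation l)))
        (+-monoʳ-≤ _ (*-monoˡ-≤ (square-nonneg t) weighted≤t)))
      where
      weighted≤t : ∑ℝ ks (λ k → c k * N (z k)) ≤ t
      weighted≤t = ≤-respʳ-≈ (trans (∑-cong ks (λ k → *-identityʳ (c k))) ∑c≈t)
        (∑-mono ks (λ k → *-monoˡ-≤ (0≤c k) (Nz≤1 k)))
      exchange : ∀ (f : K → A → Carrier) →
        ∑ℝ ks (λ k → c k * N (f k)) ≈ ∑ℝ xs (λ a → ∑ℝ ks (λ k → c k * (f k a * f k a)))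
      exchange f = trans (∑-cong ks (λ k → sym (*-distribˡ-∑ xs (c k) _))) (∑-swap ks xs _)
      eq : ∑ℝ ks (λ k → c k * (N (deviation (k ∷ l)) + N p))
             ≈ t * N (deviation l) + t * t * ∑ℝ ks (λ k → c k * N (z k))
      eq = begin
        ∑ℝ ks (λ k → c k * (N (deviation (k ∷ l)) + N p))
          ≈⟨ ∑-cong ks (λ k → distribˡ (c k) _ _) ⟩
        ∑ℝ ks (λ k → c k * N (deviation (k ∷ l)) + c k * N p)
          ≈⟨ ∑-distrib-+ ks _ _ ⟩
        ∑ℝ ks (λ k → c k * N (deviation (k ∷ l))) + ∑ℝ ks (λ k → c k * N p)
          ≈⟨ +-cong (exchange (λ k → deviation (k ∷ l)))
               (trans (*-distribʳ-∑ ks (N p) c) (trans (*-congʳ ∑c≈t) (sym (*-distribˡ-∑ xs t _)))) ⟩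
        ∑ℝ xs (λ a → ∑ℝ ks (λ k → c k * (deviation (k ∷ l) a * deviation (k ∷ l) a))) + ∑ℝ xs (λ a → t * (p a * p a))
          ≈⟨ ∑-distrib-+ xs _ _ ⟨
        ∑ℝ xs (λ a → ∑ℝ ks (λ k → c k * (deviation (k ∷ l) a * deviation (k ∷ l) a)) + t * (p a * p a))
          ≈⟨ ∑-cong xs (λ a → pointwise (deviation l a) a) ⟩
        ∑ℝ xs (λ a → t * (deviation l a * deviation l a) + t * t * ∑ℝ ks (λ k → c k * (z k a * z k a)))
          ≈⟨ ∑-distrib-+ xs _ _ ⟩
        ∑ℝ xs (λ a → t * (deviation l a * deviation l a)) + ∑ℝ xs (λ a → t * t * ∑ℝ ks (λ k → c k * (z k a * z k a)))
          ≈⟨ +-cong (*-distribˡ-∑ xs t _) (trans (*-distribˡ-∑ xs (t * t) _) (*-congˡ (sym (exchange z)))) ⟩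
        t * N (deviation l) + t * t * ∑ℝ ks (λ k → c k * N (z k)) ∎

    -- `weighted-min` finds a `k` no worse than the weighted mean, which `mean` bounds. Cancelling
    -- the nonzero `t` shows that each choice increases the squared error by at most `t * t` minus
    -- `N p`.
    greedy : K → 0# ≤ t → ¬ t ≈ 0# → ∀ j →
             Σ[ l ∈ List K ] length l ≡ j × N (deviation l) + fromℕ j * N p ≤ fromℕ j * (t * t)
    greedy k₀ 0≤t t≉0 ℕ.zero = [] , ≡.refl , ≤-reflexive (trans
      (+-cong (∑-zero xs (λ _ → zeroˡ 0#)) (zeroˡ (N p))) (trans (+-identityˡ 0#) (sym (zeroˡ (t * t)))))
    greedy k₀ 0≤t t≉0 (ℕ.suc j) with greedy k₀ 0≤t t≉0 j
    ... | l , eq , h with weighted-min c (λ k → N (deviation (k ∷ l)) + N p) 0≤c k₀ ks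
    ...   | k , min = k ∷ l , ≡.cong ℕ.suc eq , ≤-respˡ-≈
              (solve 3 (λ s m p → (s :+ p) :+ m :* p := s :+ (con 1 :+ m) :* p) refl (N (deviation (k ∷ l))) (fromℕ j) (N p))
              (≤-trans (+-mono-≤ step ≤-refl) (≤-respˡ-≈
                (solve 4 (λ s m p q → (s :+ m :* p) :+ q := (s :+ q) :+ m :* p) refl (N (deviation l)) (fromℕ j) (N p) (t * t))
                (≤-respʳ-≈ (solve 2 (λ m q → m :* q :+ q := (con 1 :+ m) :* q) refl (fromℕ j) (t * t))
                  (+-mono-≤ h ≤-refl))))
      where
      step : N (deviation (k ∷ l)) + N p ≤ N (deviation l) + t * t
      step = *-cancelˡ-≤ 0≤t t≉0 (≤-trans (≤-respˡ-≈ (*-congʳ ∑c≈t) min) (mean l))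

-- Sums over words of fixed length and over factorisations.

module WordSums (R : CompleteOrderedField) {n : ℕ} where

  open CompleteOrderedField R
  open Sums R
  open FreeStarAlgebra R using (∑ℝ)

  ∑-words-suc : ∀ d (f : Word n → Carrier) →
    ∑ℝ (words n (ℕ.suc d)) f ≈ ∑ℝ (allFin n) (λ i → ∑ℝ (words n d) (λ ω → f (i ∷ ω)))
  ∑-words-suc d f = ∑-cartesianProductWith _∷_ (allFin n) (words n d) f

  ∑-words-cong : ∀ d {f g : Word n → Carrier} → (∀ ω → length ω ≡ d → f ω ≈ g ω) →
                 ∑ℝ (words n d) f ≈ ∑ℝ (words n d) g
  ∑-words-cong ℕ.zero    f≈g = +-congʳ (f≈g [] ≡.refl)
  ∑-words-cong (ℕ.suc d) {f} {g} f≈g = trans (∑-words-suc d f) (trans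
    (∑-cong (allFin n) (λ i → ∑-words-cong d (λ ω eq → f≈g (i ∷ ω) (≡.cong ℕ.suc eq))))
    (sym (∑-words-suc d g)))

  ∑-words-++ : ∀ d e (f : Word n → Carrier) →
    ∑ℝ (words n (d ℕ.+ e)) f ≈ ∑ℝ (words n d) (λ u → ∑ℝ (words n e) (λ v → f (u ++ v)))
  ∑-words-++ ℕ.zero    e f = sym (+-identityʳ _)
  ∑-words-++ (ℕ.suc d) e f = trans (∑-words-suc (d ℕ.+ e) f) (trans
    (∑-cong (allFin n) (λ i → ∑-words-++ d e (λ ω → f (i ∷ ω))))
    (sym (∑-words-suc d _)))

  -- Splitting off the last letter instead of the first: recursion under the first letter, then an
  -- exchange of the sums over the two end letters.
  ∑-words-∷ʳ : ∀ d (f : Word n → Carrier) →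
    ∑ℝ (words n (ℕ.suc d)) f ≈ ∑ℝ (allFin n) (λ i → ∑ℝ (words n d) (λ ω → f (ω ∷ʳ i)))
  ∑-words-∷ʳ ℕ.zero    f = ∑-words-suc 0 f
  ∑-words-∷ʳ (ℕ.suc d) f = trans (∑-words-suc (ℕ.suc d) f) (trans
    (∑-cong (allFin n) (λ i → ∑-words-∷ʳ d (λ ω → f (i ∷ ω)))) (trans
    (∑-swap (allFin n) (allFin n) (λ i j → ∑ℝ (words n d) (λ ω → f (i ∷ ω ∷ʳ j))))
    (∑-cong (allFin n) (λ j → sym (∑-words-suc d (λ ω → f (ω ∷ʳ j)))))))

  -- Reversal moves the first letter to the end, and the sum can be split at either end.
  ∑-words-reverse : ∀ d (f : Word n → Carrier) →
    ∑ℝ (words n d) (f ∘ reverse) ≈ ∑ℝ (words n d) f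
  ∑-words-reverse ℕ.zero    f = refl
  ∑-words-reverse (ℕ.suc d) f = trans (∑-words-suc d (f ∘ reverse)) (trans
    (∑-cong (allFin n) (λ i → trans
      (∑-cong (words n d) (λ ω → reflexive (≡.cong f (unfold-reverse i ω))))
      (∑-words-reverse d (λ ω → f (ω ∷ʳ i)))))
    (sym (∑-words-∷ʳ d f)))

  ∈-words : ∀ (ω : Word n) → ω ∈ words n (length ω)
  ∈-words []      = here ≡.refl
  ∈-words (i ∷ ω) = ∈-cartesianProductWith⁺ _∷_ (∈-allFin i) (∈-words ω)

  -- A word has exactly one factorisation whose first factor has a given length. With a homogeneous
  -- left factor, this collapses the convolution product to a single term.
  ∑-factorisations : ∀ (u v : Word n) (f : Word n × Word n → Carrier) →
    (∀ a b → length a ≢ length u → f (a , b) ≈ 0#) →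
    ∑ℝ (factorisations (u ++ v)) f ≈ f (u , v)
  ∑-factorisations [] []      f f≈0 = +-identityʳ _
  ∑-factorisations [] (j ∷ v) f f≈0 = trans (+-congˡ (trans
    (reflexive (∑-map (map₁ (j ∷_)) (factorisations v) f))
    (∑-zero (factorisations v) (λ {ab} _ → f≈0 (j ∷ proj₁ ab) (proj₂ ab) λ ()))))
    (+-identityʳ _)
  ∑-factorisations (i ∷ u) v f f≈0 = trans
    (+-cong (f≈0 [] (i ∷ u ++ v) λ ()) (reflexive (∑-map (map₁ (i ∷_)) (factorisations (u ++ v)) f)))
    (trans (+-identityˡ _) (∑-factorisations u v (f ∘ map₁ (i ∷_))
      (λ a b a≢u → f≈0 (i ∷ a) b (a≢u ∘ ℕₚ.suc-injective))))

-- Coefficients, norms and normalisation of Hermitian squares.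

module HermitianSquares (R : CompleteOrderedField) {n : ℕ} where

  open CompleteOrderedField R hiding (_≈_; _≤_; _<_; _+_; _*_; -_; _-_; 0#; 1#; Carrier)
  open SquareRoot R
  open OrderedField R
  open Sums R
  open WordSums R {n}
  open FreeStarAlgebra R
  open ApproximateCarathéodory R using (N)
  open import Relation.Binary.Reasoning.Setoid setoid
  open import Algebra.Properties.Ring ring using (-‿distribˡ-*; -‿distribʳ-*; -‿involutive)
  open import Algebra.Solver.Ring.NaturalCoefficients.Default commutativeSemiring
    using (solve; _:=_; _:+_; _:*_)

  infixr 7 _·ᶜ_ _·ᴾ_
  infix  9 _²ᴾ

  _·ᶜ_ : ℝ → ℂ → ℂ
  x ·ᶜ a = (x * re a) +i (x * im a)

  _·ᴾ_ : ℝ → ℂ⟨z⟩ n → ℂ⟨z⟩ n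
  x ·ᴾ p = record
    { coeff    = λ ω → x ·ᶜ coeff p ω
    ; degree≤  = degree≤ p
    ; vanishes = λ ω h → let re≈0 , im≈0 = vanishes p ω h in *-0ʳ x re≈0 , *-0ʳ x im≈0
    }

  _²ᴾ : ℂ⟨z⟩ n → ℂ⟨z⟩ n
  w ²ᴾ = w ⋆ *ᴾ w

  re-∑ᶜ : ∀ {A : Set} (xs : List A) (f : A → ℂ) → re (∑ᶜ xs f) ≡ ∑ℝ xs (re ∘ f)
  re-∑ᶜ []       f = ≡.refl
  re-∑ᶜ (x ∷ xs) f = ≡.cong (re (f x) +_) (re-∑ᶜ xs f)

  im-∑ᶜ : ∀ {A : Set} (xs : List A) (f : A → ℂ) → im (∑ᶜ xs f) ≡ ∑ℝ xs (im ∘ f)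
  im-∑ᶜ []       f = ≡.refl
  im-∑ᶜ (x ∷ xs) f = ≡.cong (im (f x) +_) (im-∑ᶜ xs f)

  conj-0 : ∀ {a} → a ≈ᶜ 0ᶜ → conj a ≈ᶜ 0ᶜ
  conj-0 (re≈0 , im≈0) = re≈0 , neg-0 im≈0

  ∣∣²-cong : ∀ a b → a ≈ᶜ b → ∣ a ∣² ≈ ∣ b ∣²
  ∣∣²-cong a b (re≈ , im≈) = +-cong (*-cong re≈ re≈) (*-cong im≈ im≈)

  ∣∣²-0 : ∀ a → a ≈ᶜ 0ᶜ → ∣ a ∣² ≈ 0#
  ∣∣²-0 a (re≈0 , im≈0) = +-0 (*-0ˡ _ re≈0) (*-0ˡ _ im≈0)

  ∣∣²≤0⇒≈0 : ∀ {a} → ∣ a ∣² ≤ 0# → a ≈ᶜ 0ᶜ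
  ∣∣²≤0⇒≈0 {a} h = square≤0⇒≈0 (≤-trans (x≤x+y _ (square-nonneg (im a))) h)
                 , square≤0⇒≈0 (≤-trans (x≤x+y _ (square-nonneg (re a))) (≤-respˡ-≈ (+-comm _ _) h))

  re-conj-* : ∀ a b → re (conj a *ᶜ b) ≈ re a * re b + im a * im b
  re-conj-* a b = +-congˡ (trans (-‿distribˡ-* (- im a) (im b)) (*-congʳ (-‿involutive (im a))))

  -- The two-square identity. The solver sees `- im a` as an atom `m`; afterwards `m * m` becomes
  -- `im a * im a` and the cross terms, multiples of `im a + m`, vanish.
  ∣conj*∣² : ∀ a b → ∣ conj a *ᶜ b ∣² ≈ ∣ a ∣² * ∣ b ∣²
  ∣conj*∣² a b = begin
    ∣ conj a *ᶜ b ∣²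
      ≈⟨ +-congʳ (*-cong (re-conj-* a b) (re-conj-* a b)) ⟩
    (re a * re b + im a * im b) * (re a * re b + im a * im b) + (re a * im b + m * re b) * (re a * im b + m * re b)
      ≈⟨ solve 5 (λ a a′ m b b′ →
           (a :* b :+ a′ :* b′) :* (a :* b :+ a′ :* b′) :+ (a :* b′ :+ m :* b) :* (a :* b′ :+ m :* b) :=
           a :* a :* (b :* b) :+ a′ :* a′ :* (b′ :* b′) :+ a :* a :* (b′ :* b′) :+ m :* m :* (b :* b)
             :+ (a :* b :* b′ :+ a :* b :* b′) :* (a′ :+ m)) refl (re a) (im a) m (re b) (im b) ⟩
    re a * re a * (re b * re b) + im a * im a * (im b * im b) + re a * re a * (im b * im b) + m * m * (re b * re b)
      + (re a * re b * im b + re a * re b * im b) * (im a + m)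
      ≈⟨ +-cong (+-congˡ (*-congʳ (+≈0⇒squares≈ (-‿inverseˡ (im a))))) (*-0ʳ _ (-‿inverseʳ (im a))) ⟩
    re a * re a * (re b * re b) + im a * im a * (im b * im b) + re a * re a * (im b * im b) + im a * im a * (re b * re b) + 0#
      ≈⟨ +-identityʳ _ ⟩
    re a * re a * (re b * re b) + im a * im a * (im b * im b) + re a * re a * (im b * im b) + im a * im a * (re b * re b)
      ≈⟨ solve 4 (λ a a′ b b′ → a :* b :+ a′ :* b′ :+ a :* b′ :+ a′ :* b := (a :+ a′) :* (b :+ b′)) refl
           (re a * re a) (im a * im a) (re b * re b) (im b * im b) ⟩
    ∣ a ∣² * ∣ b ∣² ∎
    where m = - im a

  -- `w ⋆` vanishes on words of length other than `d`, so only the cut after `u` survives. Indexed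
  -- by `u` and `v`, the coefficients form an array of rank one.
  ²ᴾ-coeff : ∀ {d} w → Homogeneous d w → ∀ u v → length u ≡ d →
             coeff (w ²ᴾ) (u ++ v) ≈ᶜ conj (coeff w (reverse u)) *ᶜ coeff w v
  ²ᴾ-coeff {d} w hom u v ∣u∣≡d =
      trans (reflexive (re-∑ᶜ (factorisations (u ++ v)) _))
        (∑-factorisations u v _ λ a b a≢u → proj₁ (term≈0 a b a≢u))
    , trans (reflexive (im-∑ᶜ (factorisations (u ++ v)) _))
        (∑-factorisations u v _ λ a b a≢u → proj₂ (term≈0 a b a≢u))
    where
    term≈0 : ∀ a b → length a ≢ length u → conj (coeff w (reverse a)) *ᶜ coeff w b ≈ᶜ 0ᶜ
    term≈0 a b a≢u = *ᶜ-0ˡ (coeff w b) (conj-0 (hom (reverse a)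
      λ eq → a≢u (≡.trans (≡.trans (≡.sym (length-reverse a)) eq) (≡.sym ∣u∣≡d))))

  ²ᴾ-homogeneous : ∀ {d} w → Homogeneous d w → Homogeneous (d ℕ.+ d) (w ²ᴾ)
  ²ᴾ-homogeneous {d} w hom ω ∣ω∣≢ = ∑ᶜ-0 (All.map (λ {uv} → term≈0 (proj₁ uv) (proj₂ uv)) (factorisations-length ω))
    where
    term≈0 : ∀ u v → length u ℕ.+ length v ≡ length ω → conj (coeff w (reverse u)) *ᶜ coeff w v ≈ᶜ 0ᶜ
    term≈0 u v eq with length u ℕₚ.≟ d | length v ℕₚ.≟ d
    ... | no u≢      | _          = *ᶜ-0ˡ (coeff w v) (conj-0 (hom (reverse u) (u≢ ∘ ≡.trans (≡.sym (length-reverse u)))))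
    ... | yes _      | no v≢      = *ᶜ-0ʳ (conj (coeff w (reverse u))) (hom v v≢)
    ... | yes ∣u∣≡d  | yes ∣v∣≡d  = contradiction (≡.trans (≡.sym eq) (≡.cong₂ ℕ._+_ ∣u∣≡d ∣v∣≡d)) ∣ω∣≢

  -- For `w` homogeneous of degree `d` this is the squared 2-norm of `w` and, by `²ᴾ-palindrome`,
  -- the palindrome sum of `w ²ᴾ`.
  weight : ℕ → ℂ⟨z⟩ n → ℝ
  weight d w = ∑ℝ (words n d) (λ ν → ∣ coeff w ν ∣²)

  weight-nonneg : ∀ d w → 0# ≤ weight d w
  weight-nonneg d w = ∑ℝ-nonneg (words n d) (λ ν → ∣∣²-nonneg (coeff w ν))

  -- On words of length `d + d` the rank-one form makes the sum a product of two copies of the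
  -- weight, one of them over reversed words. It is an inequality because the range of lengths up to
  -- `e` may stop short of `d + d`.
  ∑∣²ᴾ∣²≤weight² : ∀ {d} w → Homogeneous d w → ∀ e →
    ∑ℝ (words≤ n e) (λ ω → ∣ coeff (w ²ᴾ) ω ∣²) ≤ weight d w * weight d w
  ∑∣²ᴾ∣²≤weight² {d} w hom e = ≤-respˡ-≈ (sym (∑-concatMap (words n) (upTo (ℕ.suc e)) _))
    (∑-single-≤ (d ℕ.+ d) (upTo⁺ (ℕ.suc e)) (*-nonneg (weight-nonneg d w) (weight-nonneg d w)) other≈0 (≤-reflexive main))
    where
    other≈0 : ∀ m → m ≢ d ℕ.+ d → ∑ℝ (words n m) (λ ω → ∣ coeff (w ²ᴾ) ω ∣²) ≈ 0#
    other≈0 m m≢ = trans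
      (∑-words-cong m (λ { ω ≡.refl → ∣∣²-0 (coeff (w ²ᴾ) ω) (²ᴾ-homogeneous w hom ω m≢) }))
      (∑-zero (words n m) (λ _ → refl))
    main : ∑ℝ (words n (d ℕ.+ d)) (λ ω → ∣ coeff (w ²ᴾ) ω ∣²) ≈ weight d w * weight d w
    main = begin
      ∑ℝ (words n (d ℕ.+ d)) (λ ω → ∣ coeff (w ²ᴾ) ω ∣²)
        ≈⟨ ∑-words-++ d d _ ⟩
      ∑ℝ (words n d) (λ u → ∑ℝ (words n d) (λ v → ∣ coeff (w ²ᴾ) (u ++ v) ∣²))
        ≈⟨ ∑-words-cong d (λ u ∣u∣≡d → trans
             (∑-cong (words n d) (λ v → trans (∣∣²-cong _ _ (²ᴾ-coeff w hom u v ∣u∣≡d)) (∣conj*∣² _ (coeff w v))))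
             (*-distribˡ-∑ (words n d) _ _)) ⟩
      ∑ℝ (words n d) (λ u → ∣ coeff w (reverse u) ∣² * weight d w)
        ≈⟨ *-distribʳ-∑ (words n d) (weight d w) _ ⟩
      ∑ℝ (words n d) (λ u → ∣ coeff w (reverse u) ∣²) * weight d w
        ≈⟨ *-congʳ (∑-words-reverse d (λ u → ∣ coeff w u ∣²)) ⟩
      weight d w * weight d w ∎

  -- A diagonal entry of the rank-one array: reversing `reverse ν` gives back `ν`, so a coefficient
  -- is multiplied by its own conjugate.
  ²ᴾ-palindrome : ∀ {d} w → Homogeneous d w → ∀ ν → length ν ≡ d →
                  coeff (w ²ᴾ) (reverse ν ++ ν) ≈ᶜ ofℝ ∣ coeff w ν ∣²
  ²ᴾ-palindrome {d} w hom ν ∣ν∣≡d with ²ᴾ-coeff w hom (reverse ν) ν (≡.trans (length-reverse ν) ∣ν∣≡d)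
  ... | eq rewrite reverse-involutive ν =
      trans (proj₁ eq) (re-conj-* a a)
    , trans (proj₂ eq) (trans (+-congˡ (*-comm (- im a) (re a)))
        (trans (sym (distribˡ (re a) (im a) (- im a))) (*-0ʳ (re a) (-‿inverseʳ (im a)))))
    where a = coeff w ν

  conj-*-·ᶜ : ∀ x {a a′ b b′} → a ≈ᶜ x ·ᶜ a′ → b ≈ᶜ x ·ᶜ b′ →
              conj a *ᶜ b ≈ᶜ (x * x) ·ᶜ (conj a′ *ᶜ b′)
  conj-*-·ᶜ x {a} {a′} {b} {b′} (ra , ia) (rb , ib) = re-eq , im-eq
    where
    neg-eq : - im a ≈ x * - im a′
    neg-eq = trans (-‿cong ia) (-‿distribʳ-* x (im a′))
    re-eq : re (conj a *ᶜ b) ≈ x * x * re (conj a′ *ᶜ b′)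
    re-eq = begin
      re (conj a *ᶜ b)                                          ≈⟨ re-conj-* a b ⟩
      re a * re b + im a * im b                                 ≈⟨ +-cong (*-cong ra rb) (*-cong ia ib) ⟩
      x * re a′ * (x * re b′) + x * im a′ * (x * im b′)         ≈⟨ solve 5 (λ x a b c d → x :* a :* (x :* b) :+ x :* c :* (x :* d) := x :* x :* (a :* b :+ c :* d)) refl x _ _ _ _ ⟩
      x * x * (re a′ * re b′ + im a′ * im b′)                   ≈⟨ *-congˡ (re-conj-* a′ b′) ⟨
      x * x * re (conj a′ *ᶜ b′)                                ∎
    im-eq : re a * im b + - im a * re b ≈ x * x * (re a′ * im b′ + - im a′ * re b′)
    im-eq = trans (+-cong (*-cong ra ib) (*-cong neg-eq rb))
      (solve 5 (λ x a b c d → x :* a :* (x :* b) :+ x :* c :* (x :* d) := x :* x :* (a :* b :+ c :* d)) refl x _ _ _ _)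

  -- Assuming only `w ≈ᴾ x ·ᴾ v` lets this serve both for normalising a given `w` and for literal
  -- scalar multiples.
  ²ᴾ-·ᴾ : ∀ x v w → w ≈ᴾ x ·ᴾ v → w ²ᴾ ≈ᴾ (x * x) ·ᴾ v ²ᴾ
  ²ᴾ-·ᴾ x v w w≈xv ω =
      trans (reflexive (re-∑ᶜ (factorisations ω) _)) (trans
        (∑-cong (factorisations ω) (λ uv → proj₁ (term uv))) (trans
        (*-distribˡ-∑ (factorisations ω) (x * x) _) (*-congˡ (reflexive (≡.sym (re-∑ᶜ (factorisations ω) _))))))
    , trans (reflexive (im-∑ᶜ (factorisations ω) _)) (trans
        (∑-cong (factorisations ω) (λ uv → proj₂ (term uv))) (trans
        (*-distribˡ-∑ (factorisations ω) (x * x) _) (*-congˡ (reflexive (≡.sym (im-∑ᶜ (factorisations ω) _))))))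
    where
    term : ∀ uv → conj (coeff w (reverse (proj₁ uv))) *ᶜ coeff w (proj₂ uv)
                    ≈ᶜ (x * x) ·ᶜ (conj (coeff v (reverse (proj₁ uv))) *ᶜ coeff v (proj₂ uv))
    term (a , b) = conj-*-·ᶜ x (w≈xv (reverse a)) (w≈xv b)

  ·ᴾ-homogeneous : ∀ {d} x w → Homogeneous d w → Homogeneous d (x ·ᴾ w)
  ·ᴾ-homogeneous x w hom ω ∣ω∣≢d = *-0ʳ x (proj₁ (hom ω ∣ω∣≢d)) , *-0ʳ x (proj₂ (hom ω ∣ω∣≢d))

  weight≈0⇒≈0 : ∀ {d} w → Homogeneous d w → weight d w ≈ 0# → w ≈ᴾ 0ᴾ
  weight≈0⇒≈0 {d} w hom c≈0 ω with length ω ℕₚ.≟ d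
  ... | no  ∣ω∣≢d  = hom ω ∣ω∣≢d
  ... | yes ≡.refl =
    ∣∣²≤0⇒≈0 (≤-respʳ-≈ c≈0 (term≤∑ {f = λ ν → ∣ coeff w ν ∣²} (λ ν → ∣∣²-nonneg (coeff w ν)) (∈-words ω)))

  -- Divide `w` by the square root of its weight. If the weight is zero then `w` vanishes and `v` is
  -- taken to be zero, hence `≤ 1#` rather than equality.
  normalise : ∀ {d} w → Homogeneous d w →
              ∃[ v ] Homogeneous d v × weight d v ≤ 1# × w ²ᴾ ≈ᴾ weight d w ·ᴾ v ²ᴾ
  normalise {d} w hom = go (weight d w ≟ 0#) (sqrt-exists (weight d w) (weight-nonneg d w))
    where
    via : ∀ {s} v → s * s ≈ weight d w → w ≈ᴾ s ·ᴾ v → w ²ᴾ ≈ᴾ weight d w ·ᴾ v ²ᴾ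
    via {s} v ss≈c w≈sv ω = trans (proj₁ (²ᴾ-·ᴾ s v w w≈sv ω)) (*-congʳ ss≈c) , trans (proj₂ (²ᴾ-·ᴾ s v w w≈sv ω)) (*-congʳ ss≈c)
    go : Dec (weight d w ≈ 0#) → ∃[ s ] 0# ≤ s × s * s ≈ weight d w →
         ∃[ v ] Homogeneous d v × weight d v ≤ 1# × w ²ᴾ ≈ᴾ weight d w ·ᴾ v ²ᴾ
    go (yes c≈0) (s , _ , ss≈c) = 0ᴾ , (λ _ _ → refl , refl)
      , ≤-respˡ-≈ (sym (∑-zero (words n d) (λ _ → ∣∣²-0 0ᶜ (refl , refl)))) 0≤1
      , via 0ᴾ ss≈c (λ ω → trans (proj₁ (weight≈0⇒≈0 w hom c≈0 ω)) (sym (zeroʳ s))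
                               , trans (proj₂ (weight≈0⇒≈0 w hom c≈0 ω)) (sym (zeroʳ s)))
    go (no c≉0) (s , _ , ss≈c) = r ·ᴾ w , ·ᴾ-homogeneous r w hom
      , ≤-reflexive weight≈1
      , via (r ·ᴾ w) ss≈c (λ ω → s·r· (re (coeff w ω)) , s·r· (im (coeff w ω)))
      where
      inverse = invertible s (λ s≈0 → c≉0 (trans (sym ss≈c) (*-0ˡ s s≈0)))
      r = proj₁ inverse
      sr≈1 : s * r ≈ 1#
      sr≈1 = proj₂ (proj₂ inverse)
      s·r· : ∀ x → x ≈ s * (r * x)
      s·r· x = trans (sym (*-identityˡ x)) (trans (*-congʳ (sym sr≈1)) (*-assoc s r x))
      weight≈1 : weight d (r ·ᴾ w) ≈ 1#
      weight≈1 = begin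
        weight d (r ·ᴾ w)
          ≈⟨ ∑-cong (words n d) (λ ν → solve 3 (λ r a b → r :* a :* (r :* a) :+ r :* b :* (r :* b) := r :* r :* (a :* a :+ b :* b))
               refl r (re (coeff w ν)) (im (coeff w ν))) ⟩
        ∑ℝ (words n d) (λ ν → r * r * ∣ coeff w ν ∣²)  ≈⟨ *-distribˡ-∑ (words n d) (r * r) _ ⟩
        r * r * weight d w                            ≈⟨ *-congˡ ss≈c ⟨
        r * r * (s * s)                               ≈⟨ solve 2 (λ r s → r :* r :* (s :* s) := s :* r :* (s :* r)) refl r s ⟩
        s * r * (s * r)                               ≈⟨ *-cong sr≈1 sr≈1 ⟩
        1# * 1#                                       ≈⟨ *-identityˡ 1# ⟩
        1#                                            ∎

  -- Polynomials as vectors of real coordinates, to which the approximation argument applies.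

  coords : ℂ⟨z⟩ n → Word n × Bool → ℝ
  coords p (ω , true)  = re (coeff p ω)
  coords p (ω , false) = im (coeff p ω)

  positions : ℕ → List (Word n × Bool)
  positions e = cartesianProduct (words≤ n e) (true ∷ false ∷ [])

  N-coords : ∀ e p → N (positions e) (coords p) ≈ ∑ℝ (words≤ n e) (λ ω → ∣ coeff p ω ∣²)
  N-coords e p = trans (∑-cartesianProductWith _,_ (words≤ n e) (true ∷ false ∷ []) (λ a → coords p a * coords p a))
    (∑-cong (words≤ n e) (λ ω → +-congˡ (+-identityʳ _)))

  coords-cong : ∀ p q → p ≈ᴾ q → ∀ a → coords p a ≈ coords q a
  coords-cong p q p≈q (ω , true)  = proj₁ (p≈q ω)
  coords-cong p q p≈q (ω , false) = proj₂ (p≈q ω)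

  coords-·ᴾ : ∀ x p a → coords (x ·ᴾ p) a ≈ x * coords p a
  coords-·ᴾ x p (ω , true)  = refl
  coords-·ᴾ x p (ω , false) = refl

  coords--ᴾ : ∀ p q a → coords (p -ᴾ q) a ≈ coords p a - coords q a
  coords--ᴾ p q (ω , true)  = refl
  coords--ᴾ p q (ω , false) = refl

  -- A general `κ` lets the recursion pass to `κ ∘ Fin.suc`; it is used with `id` for the given
  -- squares and with `lookup l` for a sample.
  coords-∑ᴾ : ∀ {K : Set} {m} (W : K → ℂ⟨z⟩ n) (κ : Fin m → K) a →
              coords (∑ᴾ (λ i → W (κ i))) a ≈ ∑ℝ (tabulate κ) (λ k → coords (W k) a)
  coords-∑ᴾ {m = ℕ.zero}  W κ (ω , true)  = refl
  coords-∑ᴾ {m = ℕ.zero}  W κ (ω , false) = refl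
  coords-∑ᴾ {m = ℕ.suc m} W κ (ω , true)  = +-congˡ (coords-∑ᴾ W (κ ∘ Fin.suc) (ω , true))
  coords-∑ᴾ {m = ℕ.suc m} W κ (ω , false) = +-congˡ (coords-∑ᴾ W (κ ∘ Fin.suc) (ω , false))

  ∑ᴾ-homogeneous : ∀ {d m} (f : Fin m → ℂ⟨z⟩ n) → (∀ i → Homogeneous d (f i)) → Homogeneous d (∑ᴾ f)
  ∑ᴾ-homogeneous {m = ℕ.zero}  f hom ω ∣ω∣≢d = refl , refl
  ∑ᴾ-homogeneous {m = ℕ.suc m} f hom ω ∣ω∣≢d =
    +ᶜ-0 (hom Fin.zero ω ∣ω∣≢d) (∑ᴾ-homogeneous (f ∘ Fin.suc) (hom ∘ Fin.suc) ω ∣ω∣≢d)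

  -- The degree bound carried by a sum of products varies with its terms, and the norm sums up to
  -- that bound. Homogeneity allows a uniform one.
  withDegree : ∀ d p → Homogeneous d p → ℂ⟨z⟩ n
  withDegree d p hom = record
    { coeff = coeff p ; degree≤ = d ; vanishes = λ ω d<∣ω∣ → hom ω (ℕₚ.>⇒≢ d<∣ω∣) }

  -- Both sides are nonnegative, so it suffices to compare squares, which removes the root from the
  -- norm.
  ball-N : ∀ p q {ε} → 0# ≤ ε → N (positions (degree≤ p ℕ.⊔ degree≤ q)) (coords (p -ᴾ q)) ≤ ε * ε → Ball p ε q
  ball-N p q {ε} 0≤ε h = square-cancel-≤ 0≤ε
    (≤-respˡ-≈ (sym (trans (proj₂ (proj₂ (sqrt-exists ∥ p -ᴾ q ∥₂² ∥∥²-nonneg)))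
                           (sym (N-coords (degree≤ p ℕ.⊔ degree≤ q) (p -ᴾ q))))) h)
    where
    ∥∥²-nonneg : 0# ≤ ∥ p -ᴾ q ∥₂²
    ∥∥²-nonneg = ∑ℝ-nonneg (words≤ n (degree≤ (p -ᴾ q))) (λ ω → ∣∣²-nonneg (coeff (p -ᴾ q) ω))

-- Approximating a given sum of squares by few squares.

module SumOfSquares (R : CompleteOrderedField) {n : ℕ} (d : ℕ) where

  open FreeStarAlgebra R
  open CompleteOrderedField R hiding (_≈_; _≤_; _<_; _+_; _*_; -_; _-_; 0#; 1#; Carrier)
  open SquareRoot R
  open OrderedField R
  open Sums R
  open WordSums R {n}
  open HermitianSquares R {n}
  open ApproximateCarathéodory R using (N; N-nonneg; N-rescale; deviation; deviation-expand; greedy)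
  open import Relation.Binary.Reasoning.Setoid setoid
  open import Algebra.Solver.Ring.NaturalCoefficients.Default commutativeSemiring
    using (solve; _:=_; _:*_)

  module _ (p : ℂ⟨z⟩ n) {M : ℕ} (w : Fin M → ℂ⟨z⟩ n) (hom : ∀ k → Homogeneous d (w k))
           (p≈∑ : p ≈ᴾ ∑ᴾ (λ k → w k ⋆ *ᴾ w k)) where

    c : Fin M → ℝ
    c k = weight d (w k)

    t : ℝ
    t = ∑ℝ (allFin M) c

    0≤c : ∀ k → 0# ≤ c k
    0≤c k = weight-nonneg d (w k)

    0≤t : 0# ≤ t
    0≤t = ∑ℝ-nonneg (allFin M) 0≤c

    v : Fin M → ℂ⟨z⟩ n
    v k = proj₁ (normalise (w k) (hom k))

    v-homogeneous : ∀ k → Homogeneous d (v k)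
    v-homogeneous k = proj₁ (proj₂ (normalise (w k) (hom k)))

    z : Fin M → Word n × Bool → ℝ
    z k = coords (v k ²ᴾ)

    -- The squared norm is at most the squared weight of `v k`, and a weight at most one is no
    -- smaller than its square.
    Nz≤1 : ∀ e k → N (positions e) (z k) ≤ 1#
    Nz≤1 e k = ≤-respˡ-≈ (sym (N-coords e (v k ²ᴾ)))
      (≤-trans (∑∣²ᴾ∣²≤weight² (v k) (v-homogeneous k) e) (≤-trans (*-monoˡ-≤ (weight-nonneg d (v k)) weight≤1)
        (≤-respˡ-≈ (sym (*-identityʳ _)) weight≤1)))
      where
      weight≤1 : weight d (v k) ≤ 1#
      weight≤1 = proj₁ (proj₂ (proj₂ (normalise (w k) (hom k))))

    p≈∑w² : ∀ a → coords p a ≈ ∑ℝ (allFin M) (λ k → coords (w k ²ᴾ) a)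
    p≈∑w² a = trans (coords-cong p (∑ᴾ (λ k → w k ²ᴾ)) p≈∑ a) (coords-∑ᴾ (λ k → w k ²ᴾ) id a)

    ∑cz≈p : ∀ a → ∑ℝ (allFin M) (λ k → c k * z k a) ≈ coords p a
    ∑cz≈p a = trans (∑-cong (allFin M) (λ k → sym (trans
      (coords-cong (w k ²ᴾ) (c k ·ᴾ v k ²ᴾ) (proj₂ (proj₂ (proj₂ (normalise (w k) (hom k))))) a)
      (coords-·ᴾ (c k) (v k ²ᴾ) a)))) (sym (p≈∑w² a))

    -- Expand `p` into its squares, evaluate each by `²ᴾ-palindrome`, and exchange the sums over
    -- words and squares.
    palindromeSum≈t : palindromeSum d p ≈ᶜ ofℝ t
    palindromeSum≈t =
        trans (reflexive (re-∑ᶜ (words n d) _)) (trans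
          (∑-words-cong d (λ ν ∣ν∣≡d → trans (p≈∑w² (reverse ν ++ ν , true))
            (∑-cong (allFin M) (λ k → proj₁ (²ᴾ-palindrome (w k) (hom k) ν ∣ν∣≡d)))))
          (∑-swap (words n d) (allFin M) _))
      , trans (reflexive (im-∑ᶜ (words n d) _)) (trans
          (∑-words-cong d (λ ν ∣ν∣≡d → trans (p≈∑w² (reverse ν ++ ν , false)) (trans
            (∑-cong (allFin M) (λ k → proj₂ (²ᴾ-palindrome (w k) (hom k) ν ∣ν∣≡d)))
            (∑-zero (allFin M) (λ _ → refl)))))
          (∑-zero (words n d) (λ _ → refl)))

    -- Every weight lies between zero and `t`.
    t≈0⇒p≈0 : t ≈ 0# → ∀ a → coords p a ≈ 0#
    t≈0⇒p≈0 t≈0 a = trans (sym (∑cz≈p a)) (∑-zero (allFin M) (λ {k} k∈ →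
      *-0ˡ (z k a) (antisym (≤-respʳ-≈ t≈0 (term≤∑ 0≤c k∈)) (0≤c k))))

    -- The hypothesis divided by `ε * ε`. The quotient is complex, so its imaginary part must also
    -- vanish; it does because the palindrome sum is real.
    count-bound : ∀ m {ε} (0<ε : 0# < ε) → fromℕ m * (ε * ε) ≤ t * t →
      ofℝ (fromℕ m) ≤ᶜ divide (palindromeSum d p *ᶜ palindromeSum d p) (ε * ε) (0<⇒square≉0 0<ε)
    count-bound m {ε} 0<ε mεε≤tt = re≤ , im≈
      where
      P = palindromeSum d p
      inverse = invertible (ε * ε) (0<⇒square≉0 0<ε)
      r = proj₁ inverse
      εεr≈1 : ε * ε * r ≈ 1#
      εεr≈1 = proj₂ (proj₂ inverse)
      reP≈t = proj₁ palindromeSum≈t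
      imP≈0 = proj₂ palindromeSum≈t
      re-P² : re (P *ᶜ P) ≈ t * t
      re-P² = trans (+-cong (*-cong reP≈t reP≈t) (neg-0 (*-0ˡ (im P) imP≈0))) (+-identityʳ _)
      im-P² : im (P *ᶜ P) ≈ 0#
      im-P² = +-0 (*-0ʳ (re P) imP≈0) (*-0ˡ (re P) imP≈0)
      re≤ : fromℕ m ≤ re (P *ᶜ P) * r + - (im (P *ᶜ P) * 0#)
      re≤ = ≤-respˡ-≈ (trans (solve 3 (λ m e r → r :* (m :* e) := e :* r :* m) refl (fromℕ m) (ε * ε) r)
                        (trans (*-congʳ εεr≈1) (*-identityˡ _)))
            (≤-respʳ-≈ (trans (*-comm r (t * t)) (trans (*-congʳ (sym re-P²)) (sym
              (trans (+-congˡ (neg-0 (zeroʳ (im (P *ᶜ P))))) (+-identityʳ _)))))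
              (*-monoˡ-≤ (inverse-nonneg (square-nonneg ε) εεr≈1) mεε≤tt))
      im≈ : 0# ≈ re (P *ᶜ P) * 0# + im (P *ᶜ P) * r
      im≈ = sym (+-0 (zeroʳ _) (*-0ˡ r im-P²))

    -- The scaling goes inside the squares, as a factor `s` on each `v k`, so that a scaled sum is
    -- again a sum of `length l` squares. Repeated indices count separately.
    sumOfScaled : ℝ → List (Fin M) → ℂ⟨z⟩ n
    sumOfScaled s l = withDegree (d ℕ.+ d) (∑ᴾ (λ i → (s ·ᴾ v (lookup l i)) ²ᴾ))
      (∑ᴾ-homogeneous _ (λ i → ²ᴾ-homogeneous (s ·ᴾ v (lookup l i)) (·ᴾ-homogeneous s (v (lookup l i)) (v-homogeneous (lookup l i)))))

    sumOfScaled-isSumOfSquares : ∀ s l → IsSumOfSquares d (length l) (sumOfScaled s l)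
    sumOfScaled-isSumOfSquares s l =
      (λ i → s ·ᴾ v (lookup l i)) , (λ i → ·ᴾ-homogeneous s (v (lookup l i)) (v-homogeneous (lookup l i))) , (λ ω → refl , refl)

    coords-sumOfScaled : ∀ s l a → coords (sumOfScaled s l) a ≈ s * s * ∑ℝ l (λ k → z k a)
    coords-sumOfScaled s l a = begin
      coords (sumOfScaled s l) a
        ≈⟨ same a ⟩
      coords (∑ᴾ (λ i → (s ·ᴾ v (lookup l i)) ²ᴾ)) a
        ≈⟨ coords-∑ᴾ (λ k → (s ·ᴾ v k) ²ᴾ) (lookup l) a ⟩
      ∑ℝ (tabulate (lookup l)) (λ k → coords ((s ·ᴾ v k) ²ᴾ) a)
        ≈⟨ reflexive (≡.cong (λ l → ∑ℝ l (λ k → coords ((s ·ᴾ v k) ²ᴾ) a)) (tabulate-lookup l)) ⟩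
      ∑ℝ l (λ k → coords ((s ·ᴾ v k) ²ᴾ) a)
        ≈⟨ ∑-cong l (λ k → trans
             (coords-cong ((s ·ᴾ v k) ²ᴾ) ((s * s) ·ᴾ v k ²ᴾ) (²ᴾ-·ᴾ s (v k) (s ·ᴾ v k) (λ _ → refl , refl)) a)
             (coords-·ᴾ (s * s) (v k ²ᴾ) a)) ⟩
      ∑ℝ l (λ k → s * s * z k a)
        ≈⟨ *-distribˡ-∑ l (s * s) _ ⟩
      s * s * ∑ℝ l (λ k → z k a) ∎
      where
      -- Only the degree bound differs, but `coords` computes only once the Boolean is known.
      same : ∀ a → coords (sumOfScaled s l) a ≈ coords (∑ᴾ (λ i → (s ·ᴾ v (lookup l i)) ²ᴾ)) a
      same (ω , true)  = refl
      same (ω , false) = refl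

    -- All candidates for q are given the degree bound 2d, so one seminorm
    -- measures p and every p - q.
    e : ℕ
    e = degree≤ p ℕ.⊔ (d ℕ.+ d)

    Np : ℝ
    Np = N (positions e) (coords p)

    Approximation : ∀ {ε} → 0# < ε → Set
    Approximation {ε} 0<ε = ∃[ q ] Ball p ε q ×
      (∃[ m ] IsSumOfSquares d m q ×
        ofℝ (fromℕ m) ≤ᶜ divide (palindromeSum d p *ᶜ palindromeSum d p) (ε * ε) (0<⇒square≉0 0<ε))

    N-cong : ∀ {f g : Word n × Bool → ℝ} → (∀ a → f a ≈ g a) → N (positions e) f ≈ N (positions e) g
    N-cong f≈g = ∑-cong (positions e) (λ a → *-cong (f≈g a) (f≈g a))

    module _ {ε : ℝ} (0<ε : 0# < ε) where

      0≤ε : 0# ≤ ε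
      0≤ε = proj₁ 0<ε

      -- The zero polynomial is taken as an empty `sumOfScaled`, whose degree bound `d + d` makes
      -- `ball-N` measure the error on `positions e`.
      small : Np ≤ ε * ε → Approximation 0<ε
      small Np≤εε = sumOfScaled 0# [] , ball-N p (sumOfScaled 0# []) 0≤ε (≤-respˡ-≈ (sym (N-cong p-q≈p)) Np≤εε)
        , 0 , sumOfScaled-isSumOfSquares 0# [] , count-bound 0 0<ε (≤-respˡ-≈ (sym (zeroˡ _)) (square-nonneg t))
        where
        p-q≈p : ∀ a → coords (p -ᴾ sumOfScaled 0# []) a ≈ coords p a
        p-q≈p a = trans (coords--ᴾ p (sumOfScaled 0# []) a)
          (trans (+-congˡ (neg-0 (trans (coords-sumOfScaled 0# [] a) (zeroʳ _)))) (+-identityʳ _))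

      few : fromℕ M * (ε * ε) ≤ t * t → Approximation 0<ε
      few Mεε≤tt = p , ball-N p p 0≤ε (≤-respˡ-≈ (sym (∑-zero (positions (degree≤ p ℕ.⊔ degree≤ p)) λ {a} _ →
          *-0ˡ _ (trans (coords--ᴾ p p a) (-‿inverseʳ _)))) (square-nonneg ε))
        , M , (w , hom , p≈∑) , count-bound M 0<ε Mεε≤tt

      -- A bounded search: an unbounded one for ⌊t²/ε²⌋ would need an Archimedean
      -- witness, which completeness yields only under double negation.
      floor : ∀ m → ¬ fromℕ m * (ε * ε) ≤ t * t →
              ∃[ j ] fromℕ j * (ε * ε) ≤ t * t × t * t ≤ fromℕ (ℕ.suc j) * (ε * ε)
      floor ℕ.zero    ¬0≤ = contradiction (≤-respˡ-≈ (sym (zeroˡ _)) (square-nonneg t)) ¬0≤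
      floor (ℕ.suc m) ¬≤ with fromℕ m * (ε * ε) ≤? t * t | total (t * t) (fromℕ (ℕ.suc m) * (ε * ε))
      ... | no  ¬m≤ | _       = floor m ¬m≤
      ... | yes m≤  | inj₁ ≤s = m , m≤ , ≤s
      ... | yes m≤  | inj₂ s≤ = contradiction s≤ ¬≤

      -- Supplies the default index for the greedy choice: `m` cannot be zero, since `t * t` is
      -- nonnegative.
      index : ∀ m → ¬ fromℕ m * (ε * ε) ≤ t * t → Fin m
      index ℕ.zero    ¬0≤ = contradiction (≤-respˡ-≈ (sym (zeroˡ _)) (square-nonneg t)) ¬0≤
      index (ℕ.suc m) _   = Fin.zero

      module _ (¬Np≤εε : ¬ Np ≤ ε * ε) (k₀ : Fin M) where

        t≉0 : ¬ t ≈ 0#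
        t≉0 t≈0 = ¬Np≤εε (≤-respˡ-≈ (sym (∑-zero (positions e) (λ {a} _ → *-0ˡ _ (t≈0⇒p≈0 t≈0 a)))) (square-nonneg ε))

        residual : List (Fin M) → Word n × Bool → ℝ
        residual = deviation (positions e) (allFin M) c z (coords p) t 0≤c refl ∑cz≈p (Nz≤1 e)

        residual-expand : ∀ l a → residual l a + fromℕ (length l) * coords p a ≈ t * ∑ℝ l (λ k → z k a)
        residual-expand = deviation-expand (positions e) (allFin M) c z (coords p) t 0≤c refl ∑cz≈p (Nz≤1 e)

        sample : ∀ j → Σ[ l ∈ List (Fin M) ] length l ≡ j ×
                 N (positions e) (residual l) + fromℕ j * Np ≤ fromℕ j * (t * t)
        sample = greedy (positions e) (allFin M) c z (coords p) t 0≤c refl ∑cz≈p (Nz≤1 e) k₀ 0≤t t≉0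

        -- The bound for a sample of size one, with the nonnegative residual term dropped.
        Np≤tt : Np ≤ t * t
        Np≤tt = ≤-respʳ-≈ (one (t * t)) (≤-respˡ-≈ (trans (+-identityˡ _) (one Np))
          (≤-trans (+-mono-≤ (N-nonneg (positions e) (residual (proj₁ (sample 1)))) ≤-refl) (proj₂ (proj₂ (sample 1)))))
          where
          one : ∀ x → (1# + 0#) * x ≈ x
          one x = trans (*-congʳ (+-identityʳ 1#)) (*-identityˡ x)

        fromℕ-nonneg : ∀ m → 0# ≤ fromℕ m
        fromℕ-nonneg ℕ.zero    = ≤-refl
        fromℕ-nonneg (ℕ.suc m) = +-nonneg 0≤1 (fromℕ-nonneg m)

        -- By `m * (s * s) ≈ t`, the polynomial `q` is `t / m` times the sum of the sample, so
        -- `m (q - p)` is the residual. Then `rounding` applies, because `Np` is at least `ε * ε`.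
        average-close : ∀ l s m → fromℕ (length l) ≈ m → 0# ≤ m → ¬ m ≈ 0# → m * (s * s) ≈ t →
          N (positions e) (residual l) + m * Np ≤ m * (t * t) → t * t ≤ (1# + m) * (ε * ε) →
          N (positions e) (coords (p -ᴾ sumOfScaled s l)) ≤ ε * ε
        average-close l s m ∣l∣≈m 0≤m m≉0 mss≈t h tt≤ = ≤-respˡ-≈ (sym (N-cong (coords--ᴾ p q)))
          (rounding 0≤m m≉0 (N-rescale (positions e) m (coords p) (coords q) (residual l) expand) h tt≤ (≰⇒≥ ¬Np≤εε))
          where
          q : ℂ⟨z⟩ n
          q = sumOfScaled s l
          expand : ∀ a → residual l a + m * coords p a ≈ m * coords q a
          expand a = begin
            residual l a + m * coords p a                 ≈⟨ +-congˡ (*-congʳ ∣l∣≈m) ⟨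
            residual l a + fromℕ (length l) * coords p a  ≈⟨ residual-expand l a ⟩
            t * ∑ℝ l (λ k → z k a)                        ≈⟨ *-congʳ mss≈t ⟨
            m * (s * s) * ∑ℝ l (λ k → z k a)              ≈⟨ *-assoc m (s * s) (∑ℝ l (λ k → z k a)) ⟩
            m * (s * s * ∑ℝ l (λ k → z k a))              ≈⟨ *-congˡ (coords-sumOfScaled s l a) ⟨
            m * coords q a                                ∎

        many : ∀ m → fromℕ m * (ε * ε) ≤ t * t → t * t ≤ fromℕ (ℕ.suc m) * (ε * ε) → Approximation 0<ε
        -- A floor of zero would give `t * t ≤ ε * ε`, hence `Np ≤ ε * ε`, which is excluded.
        many ℕ.zero    _  ≤s = contradiction (≤-trans Np≤tt
          (≤-respʳ-≈ (trans (*-congʳ (+-identityʳ 1#)) (*-identityˡ _)) ≤s)) ¬Np≤εε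
        many (ℕ.suc j) m≤ ≤s = build (sample (ℕ.suc j)) scaling
          where
          m : ℝ
          m = fromℕ (ℕ.suc j)
          m≉0 : ¬ m ≈ 0#
          m≉0 m≈0 = 0≉1 (antisym 0≤1 (≤-respʳ-≈ m≈0 (x≤x+y 1# (fromℕ-nonneg j))))
          -- The witness is the square root of `t / m`.
          scaling : ∃[ s ] m * (s * s) ≈ t
          scaling with invertible m m≉0
          ... | r , _ , mr≈1 with sqrt-exists (t * r) (*-nonneg 0≤t (inverse-nonneg (fromℕ-nonneg (ℕ.suc j)) mr≈1))
          ...   | s , _ , ss≈tr = s , trans (*-congˡ ss≈tr) (trans
                    (solve 3 (λ m t r → m :* (t :* r) := m :* r :* t) refl m t r) (trans (*-congʳ mr≈1) (*-identityˡ t)))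
          build : Σ[ l ∈ List (Fin M) ] length l ≡ ℕ.suc j × N (positions e) (residual l) + m * Np ≤ m * (t * t) →
                  ∃[ s ] m * (s * s) ≈ t → Approximation 0<ε
          build (l , eq , h) (s , mss≈t) = sumOfScaled s l
            , ball-N p (sumOfScaled s l) 0≤ε (average-close l s m (reflexive (≡.cong fromℕ eq))
                (fromℕ-nonneg (ℕ.suc j)) m≉0 mss≈t h ≤s)
            , length l , sumOfScaled-isSumOfSquares s l
            , count-bound (length l) 0<ε (≡.subst (λ m → fromℕ m * (ε * ε) ≤ t * t) (≡.sym eq) m≤)

      approximation : Approximation 0<ε
      approximation = cases (Np ≤? ε * ε) (fromℕ M * (ε * ε) ≤? t * t)
        where
        cases : Dec (Np ≤ ε * ε) → Dec (fromℕ M * (ε * ε) ≤ t * t) → Approximation 0<ε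
        cases (yes Np≤εε) _            = small Np≤εε
        cases (no  _)     (yes Mεε≤tt) = few Mεε≤tt
        -- Failure of the second test bounds the search for the floor by `M` and forces `M` to be
        -- positive.
        cases (no ¬Np≤εε) (no ¬Mεε≤tt) =
          let m , m≤ , ≤s = floor M ¬Mεε≤tt in many ¬Np≤εε (index M ¬Mεε≤tt) m m≤ ≤s

theorem8 : (R : CompleteOrderedField) → let open FreeStarAlgebra R in
    (n d : ℕ) (p : ℂ⟨z⟩ n) → ∑ℂ⟨z⟩² d p →
    (ε : ℝ) (0<ε : 0# < ε) →
    ∃[ q ] Ball p ε q ×
    (∃[ m ] IsSumOfSquares d m q ×
    ofℝ (fromℕ m) ≤ᶜ divide (palindromeSum d p *ᶜ palindromeSum d p) (ε * ε) (0<⇒square≉0 0<ε))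
theorem8 R n d p (M , w , hom , p≈∑) ε 0<ε = SumOfSquares.approximation R d p w hom p≈∑ 0<ε
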